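{- Let $k$ be a field and $A$ a $k$-algebra with $\dim_k A\geq 4$. Then exactly one of the following holds: (i) there exist $x,y\in A$ such that $\dim_k(k1+kx+ky+kxy)\geq 4$; (ii) there exists a $k$-subspace $V$ of $A$ with $A=k1\oplus V$ and $V\cdot V=0$; (iii) there exists a $k$-subspace $V$ of $A$ and elements $e,f\in A$ with $A=ke\oplus kf\oplus V$, $V\cdot V=eV=Vf=0$, $e^2=e$, $f^2=f$, $ef=fe=0$, $e+f=1$; equivalently $A\simeq \begin{bmatrix} k & V\\ 0 & k\end{bmatrix}$.
   Context: Here a $k$-algebra means an associative unital $k$-algebra, not necessarily commutative (case (iii) is non-commutative). For subsets $X,Y\subseteq A$, $X\cdot Y$ denotes the set (span) of products $xy$ with $x\in X$, $y\in Y$. -}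

module Defs where

open import Algebra.Bundles using (CommutativeMonoid; CommutativeRing; Ring)
import Algebra.Definitions as AlgDefs
import Algebra.Definitions.RawMonoid as RawSum
open import Algebra.Module.Bundles using (LeftModule)
open import Algebra.Module.Bundles.Raw using (RawLeftModule)
open import Algebra.Module.Structures using (IsLeftModule)
open import Algebra.Module.Morphism.Structures using (IsLeftModuleMonomorphism)
import Algebra.Module.Morphism.LeftModuleMonomorphism as LeftModuleMono
import Algebra.Module.Construct.DirectProduct as DirectProduct
import Algebra.Module.Construct.TensorUnit as TensorUnit
import Algebra.Module.Properties.LeftModule as LeftModuleProps
open import Algebra.Morphism.Structures using (module RingMorphisms)
import Algebra.Properties.CommutativeSemigroup as CommSemigroupProps
open import Data.Fin.Base using (Fin)
open import Data.Nat.Base using (ℕ)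
open import Data.Product.Base using (Σ-syntax; ∃; ∃-syntax; _×_; _,_; proj₁; proj₂)
open import Data.Sum.Base using (_⊎_)
open import Data.Vec.Functional using (Vector; []; _∷_)
open import Level using (Level; Lift; lift; _⊔_; suc)
open import Relation.Nullary.Negation using (¬_)
open import Relation.Unary using (Pred; _∈_; _≐_)
import Relation.Binary.Reasoning.Setoid as SetoidReasoning

private
  variable
    c ℓ m ℓm p q r a ℓa b ℓb : Level

ExactlyOneOf₃ : Set p → Set q → Set r → Set (p ⊔ q ⊔ r)
ExactlyOneOf₃ P Q R =
  (P ⊎ Q ⊎ R) × ¬ (P × Q) × ¬ (P × R) × ¬ (Q × R)

------------------------------------------------------------------------
-- Fields and associative unital algebras

record Field c ℓ : Set (suc (c ⊔ ℓ)) where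
  field
    commutativeRing : CommutativeRing c ℓ

  open CommutativeRing commutativeRing public
  open AlgDefs _≈_ using (Invertible)

  field
    1≉0        : ¬ (1# ≈ 0#)
    invertible : ∀ x → ¬ (x ≈ 0#) → Invertible 1# _*_ x

record Algebra (K : Field c ℓ) a ℓa : Set (c ⊔ ℓ ⊔ suc (a ⊔ ℓa)) where
  private module K = Field K

  field
    ring : Ring a ℓa

  open Ring ring public

  infixr 7 _*ₗ_
  field
    _*ₗ_         : K.Carrier → Carrier → Carrier
    isLeftModule : IsLeftModule K.ring _≈_ _+_ 0# -_ _*ₗ_
    *ₗ-*-assoc   : ∀ k x y → ((k *ₗ x) * y) ≈ (k *ₗ (x * y))
    *-*ₗ-comm    : ∀ k x y → (x * (k *ₗ y)) ≈ (k *ₗ (x * y))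

  leftModule : LeftModule K.ring a ℓa
  leftModule = record { isLeftModule = isLeftModule }

infix 4 _≅_

record _≅_ {K : Field c ℓ} (A : Algebra K a ℓa) (B : Algebra K b ℓb)
           : Set (c ⊔ a ⊔ ℓa ⊔ b ⊔ ℓb) where
  private
    module K = Field K
    module A = Algebra A
    module B = Algebra B
  open RingMorphisms A.rawRing B.rawRing using (IsRingIsomorphism)

  field
    ⟦_⟧               : A.Carrier → B.Carrier
    isRingIsomorphism : IsRingIsomorphism ⟦_⟧
    *ₗ-homo           : ∀ k x → ⟦ k A.*ₗ x ⟧ B.≈ (k B.*ₗ ⟦ x ⟧)

------------------------------------------------------------------------
-- Linear algebra

module _ {R : Ring c ℓ} (M : LeftModule R m ℓm) where
  private module R = Ring R
  open LeftModule M
  open RawSum +ᴹ-rawMonoid using (sum)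

  LinearlyIndependent : ∀ {n} → Vector Carrierᴹ n → Set (c ⊔ ℓ ⊔ ℓm)
  LinearlyIndependent {n} v =
    ∀ (k : Vector R.Carrier n) → sum (λ i → k i *ₗ v i) ≈ᴹ 0ᴹ → ∀ i → k i R.≈ R.0#

  -- The dimension as a cardinal is the supremum of the sizes of the
  -- linearly independent families, so for a natural number n it is at
  -- least n (possibly infinite) precisely in the following case.
  Dim≥ : ℕ → Set (c ⊔ ℓ ⊔ m ⊔ ℓm)
  Dim≥ n = Σ[ v ∈ Vector Carrierᴹ n ] LinearlyIndependent v

-- All subspaces live in one universe level, large enough for sums of
-- subspaces to be subspaces again.
record Subspace {R : Ring c ℓ} (M : LeftModule R m ℓm)
                : Set (suc (c ⊔ ℓ ⊔ m ⊔ ℓm)) where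
  open LeftModule M
  field
    members   : Pred Carrierᴹ (c ⊔ ℓ ⊔ m ⊔ ℓm)
    resp-≈    : ∀ {x y} → x ≈ᴹ y → x ∈ members → y ∈ members
    0-closed  : 0ᴹ ∈ members
    +-closed  : ∀ {x y} → x ∈ members → y ∈ members → (x +ᴹ y) ∈ members
    *ₗ-closed : ∀ k {x} → x ∈ members → (k *ₗ x) ∈ members

open Subspace public

module _ {R : Ring c ℓ} {M : LeftModule R m ℓm} where
  private module R = Ring R
  open LeftModule M
  open RawSum +ᴹ-rawMonoid using (sum)

  -ᴹ-closed : (V : Subspace M) → ∀ {x} → x ∈ members V → (-ᴹ x) ∈ members V
  -ᴹ-closed V {x} x∈V =
    resp-≈ V (LeftModuleProps.inverseˡ-uniqueᴹ M _ _ lem)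
             (*ₗ-closed V (R.- R.1#) x∈V)
    where
    open SetoidReasoning ≈ᴹ-setoid
    lem : ((R.- R.1#) *ₗ x) +ᴹ x ≈ᴹ 0ᴹ
    lem = begin
      ((R.- R.1#) *ₗ x) +ᴹ x             ≈⟨ +ᴹ-congˡ (*ₗ-identityˡ x) ⟨
      ((R.- R.1#) *ₗ x) +ᴹ (R.1# *ₗ x)   ≈⟨ *ₗ-distribʳ x (R.- R.1#) R.1# ⟨
      ((R.- R.1#) R.+ R.1#) *ₗ x         ≈⟨ *ₗ-congʳ (R.-‿inverseˡ R.1#) ⟩
      R.0# *ₗ x                          ≈⟨ *ₗ-zeroˡ x ⟩
      0ᴹ                                 ∎

  asModule : Subspace M → LeftModule R (c ⊔ ℓ ⊔ m ⊔ ℓm) ℓm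
  asModule V = record
    { isLeftModule =
        LeftModuleMono.isLeftModule {M = raw} {N = rawLeftModule} mono
          R.isRing isLeftModule
    }
    where
    raw : RawLeftModule R.Carrier (c ⊔ ℓ ⊔ m ⊔ ℓm) ℓm
    raw = record
      { Carrierᴹ = ∃ (members V)
      ; _≈ᴹ_     = λ x y → proj₁ x ≈ᴹ proj₁ y
      ; _+ᴹ_     = λ x y → (proj₁ x +ᴹ proj₁ y) , +-closed V (proj₂ x) (proj₂ y)
      ; _*ₗ_     = λ k x → (k *ₗ proj₁ x) , *ₗ-closed V k (proj₂ x)
      ; 0ᴹ       = 0ᴹ , 0-closed V
      ; -ᴹ_      = λ x → (-ᴹ proj₁ x) , -ᴹ-closed V (proj₂ x)
      }
    mono : IsLeftModuleMonomorphism raw rawLeftModule proj₁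
    mono = record
      { isLeftModuleHomomorphism = record
        { +ᴹ-isGroupHomomorphism = record
          { isMonoidHomomorphism = record
            { isMagmaHomomorphism = record
              { isRelHomomorphism = record { cong = λ x≈y → x≈y }
              ; homo = λ _ _ → ≈ᴹ-refl
              }
            ; ε-homo = ≈ᴹ-refl
            }
          ; ⁻¹-homo = λ _ → ≈ᴹ-refl
          }
        ; *ₗ-homo = λ _ _ → ≈ᴹ-refl
        }
      ; injective = λ x≈y → x≈y
      }

  infixl 6 _+ˢ_
  _+ˢ_ : Subspace M → Subspace M → Subspace M
  members   (U +ˢ W) x =
    ∃[ u ] ∃[ w ] u ∈ members U × w ∈ members W × x ≈ᴹ (u +ᴹ w)
  resp-≈    (U +ˢ W) x≈y (u , w , u∈ , w∈ , eq) =
    u , w , u∈ , w∈ , ≈ᴹ-trans (≈ᴹ-sym x≈y) eq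
  0-closed  (U +ˢ W) =
    0ᴹ , 0ᴹ , 0-closed U , 0-closed W , ≈ᴹ-sym (+ᴹ-identityˡ 0ᴹ)
  +-closed  (U +ˢ W) (u , w , u∈ , w∈ , eq) (u′ , w′ , u′∈ , w′∈ , eq′) =
    (u +ᴹ u′) , (w +ᴹ w′) , +-closed U u∈ u′∈ , +-closed W w∈ w′∈ ,
    ≈ᴹ-trans (+ᴹ-cong eq eq′) (interchange u w u′ w′)
    where
    open CommSemigroupProps
      (CommutativeMonoid.commutativeSemigroup +ᴹ-commutativeMonoid)
      using (interchange)
  *ₗ-closed (U +ˢ W) k (u , w , u∈ , w∈ , eq) =
    (k *ₗ u) , (k *ₗ w) , *ₗ-closed U k u∈ , *ₗ-closed W k w∈ ,
    ≈ᴹ-trans (*ₗ-congˡ eq) (*ₗ-distribˡ k u w)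

  -- M is the internal direct sum of the subspaces U i.
  IsDirectSum : ∀ {n} → Vector (Subspace M) n → Set (c ⊔ ℓ ⊔ m ⊔ ℓm)
  IsDirectSum {n} U =
    (∀ x → Σ[ u ∈ Vector Carrierᴹ n ] (∀ i → u i ∈ members (U i)) × x ≈ᴹ sum u)
    × (∀ (u : Vector Carrierᴹ n) → (∀ i → u i ∈ members (U i)) →
       sum u ≈ᴹ 0ᴹ → ∀ i → u i ≈ᴹ 0ᴹ)

  Span : Pred Carrierᴹ p → Pred Carrierᴹ (c ⊔ m ⊔ ℓm ⊔ p)
  Span P x =
    ∃[ n ] Σ[ k ∈ Vector R.Carrier n ] Σ[ v ∈ Vector Carrierᴹ n ]
      (∀ i → v i ∈ P) × x ≈ᴹ sum (λ i → k i *ₗ v i)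

Line : {R : Ring c ℓ} (M : LeftModule R m ℓm) →
       LeftModule.Carrierᴹ M → Subspace M
Line {c} {ℓ} {m} {ℓm} {R = R} M x = record
  { members   = λ y → ∃[ k ] Lift (c ⊔ ℓ ⊔ m ⊔ ℓm) (y ≈ᴹ (k *ₗ x))
  ; resp-≈    = λ y≈z (k , lift eq) → k , lift (≈ᴹ-trans (≈ᴹ-sym y≈z) eq)
  ; 0-closed  = R.0# , lift (≈ᴹ-sym (*ₗ-zeroˡ x))
  ; +-closed  = λ (k , lift eq) (l , lift eq′) →
      (k R.+ l) , lift (≈ᴹ-trans (+ᴹ-cong eq eq′) (≈ᴹ-sym (*ₗ-distribʳ x k l)))
  ; *ₗ-closed = λ l (k , lift eq) →
      (l R.* k) , lift (≈ᴹ-trans (*ₗ-congˡ eq) (≈ᴹ-sym (*ₗ-assoc l k x)))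
  }
  where
  module R = Ring R
  open LeftModule M

------------------------------------------------------------------------
-- The triangular matrix algebra

-- The triple (x , v , y) is the matrix with rows (x v) and (0 y).  Since K
-- is commutative, V is a bimodule with v·y = y *ₗ v, so that the (1,2)
-- entry x v′ + v y′ of a product is  x *ₗ v′ +ᴹ y′ *ₗ v.
Triangular : (K : Field c ℓ) → LeftModule (Field.ring K) m ℓm →
             Algebra K (c ⊔ m) (ℓ ⊔ ℓm)
Triangular K V = record
  { ring = record
    { Carrier = Carrierᴹ T
    ; _≈_     = _≈ᴹ_ T
    ; _+_     = _+ᴹ_ T
    ; _*_     = λ (x , v , y) (x′ , v′ , y′) →
                  (x K.* x′) , ((x V.*ₗ v′) V.+ᴹ (y′ V.*ₗ v)) , (y K.* y′)
    ; -_      = -ᴹ_ T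
    ; 0#      = 0ᴹ T
    ; 1#      = K.1# , V.0ᴹ , K.1#
    ; isRing  = record
      { +-isAbelianGroup = +ᴹ-isAbelianGroup T
      ; *-cong = λ (x≈ , v≈ , y≈) (x′≈ , v′≈ , y′≈) →
          K.*-cong x≈ x′≈ ,
          V.+ᴹ-cong (V.*ₗ-cong x≈ v′≈) (V.*ₗ-cong y′≈ v≈) ,
          K.*-cong y≈ y′≈
      ; *-assoc = λ (x , u , y) (x′ , u′ , y′) (x″ , u″ , y″) →
          K.*-assoc x x′ x″ , assoc x x′ u u′ u″ y′ y″ , K.*-assoc y y′ y″
      ; *-identity =
          (λ (x , v , y) → K.*-identityˡ x ,
             V.≈ᴹ-trans (V.+ᴹ-cong (V.*ₗ-identityˡ v) (V.*ₗ-zeroʳ y))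
                        (V.+ᴹ-identityʳ v) ,
             K.*-identityˡ y) ,
          (λ (x , v , y) → K.*-identityʳ x ,
             V.≈ᴹ-trans (V.+ᴹ-cong (V.*ₗ-zeroʳ x) (V.*ₗ-identityˡ v))
                        (V.+ᴹ-identityˡ v) ,
             K.*-identityʳ y)
      ; distrib =
          (λ (x , u , y) (x′ , u′ , y′) (x″ , u″ , y″) →
             K.distribˡ x x′ x″ ,
             V.≈ᴹ-trans (V.+ᴹ-cong (V.*ₗ-distribˡ x u′ u″)
                                   (V.*ₗ-distribʳ u y′ y″))
                        (interchange _ _ _ _) ,
             K.distribˡ y y′ y″) ,
          (λ (x , u , y) (x′ , u′ , y′) (x″ , u″ , y″) →
             K.distribʳ x x′ x″ ,
             V.≈ᴹ-trans (V.+ᴹ-cong (V.*ₗ-distribʳ u x′ x″)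
                                   (V.*ₗ-distribˡ y u′ u″))
                        (interchange _ _ _ _) ,
             K.distribʳ y y′ y″)
      }
    }
  ; _*ₗ_         = _*ₗ_ T
  ; isLeftModule = isLeftModule T
  ; *ₗ-*-assoc   = λ k (x , v , y) (x′ , v′ , y′) →
      K.*-assoc k x x′ ,
      V.≈ᴹ-trans (V.+ᴹ-cong (V.*ₗ-assoc k x v′) (swap y′ k v))
                 (V.≈ᴹ-sym (V.*ₗ-distribˡ k _ _)) ,
      K.*-assoc k y y′
  ; *-*ₗ-comm    = λ k (x , v , y) (x′ , v′ , y′) →
      swapK x k x′ ,
      V.≈ᴹ-trans (V.+ᴹ-cong (swap x k v′) (V.*ₗ-assoc k y′ v))
                 (V.≈ᴹ-sym (V.*ₗ-distribˡ k _ _)) ,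
      swapK y k y′
  }
  where
  open LeftModule
  module K = Field K
  module V = LeftModule V

  T = DirectProduct.leftModule (TensorUnit.leftModule {R = K.ring})
        (DirectProduct.leftModule V (TensorUnit.leftModule {R = K.ring}))

  open CommSemigroupProps
    (CommutativeMonoid.commutativeSemigroup V.+ᴹ-commutativeMonoid)
    using (interchange)

  swap : ∀ k l v → (k V.*ₗ (l V.*ₗ v)) V.≈ᴹ (l V.*ₗ (k V.*ₗ v))
  swap k l v = V.≈ᴹ-trans (V.≈ᴹ-sym (V.*ₗ-assoc k l v))
    (V.≈ᴹ-trans (V.*ₗ-congʳ (K.*-comm k l)) (V.*ₗ-assoc l k v))

  swapK : ∀ x k y → (x K.* (k K.* y)) K.≈ (k K.* (x K.* y))
  swapK x k y = K.trans (K.sym (K.*-assoc x k y))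
    (K.trans (K.*-congʳ (K.*-comm x k)) (K.*-assoc k x y))

  assoc : ∀ x x′ u u′ u″ y′ y″ →
    (((x K.* x′) V.*ₗ u″) V.+ᴹ (y″ V.*ₗ ((x V.*ₗ u′) V.+ᴹ (y′ V.*ₗ u))))
    V.≈ᴹ
    ((x V.*ₗ ((x′ V.*ₗ u″) V.+ᴹ (y″ V.*ₗ u′))) V.+ᴹ ((y′ K.* y″) V.*ₗ u))
  assoc x x′ u u′ u″ y′ y″ = begin
    ((x K.* x′) V.*ₗ u″) V.+ᴹ (y″ V.*ₗ ((x V.*ₗ u′) V.+ᴹ (y′ V.*ₗ u)))
      ≈⟨ V.+ᴹ-cong (V.*ₗ-assoc x x′ u″) (V.*ₗ-distribˡ y″ _ _) ⟩
    (x V.*ₗ (x′ V.*ₗ u″)) V.+ᴹ ((y″ V.*ₗ (x V.*ₗ u′)) V.+ᴹ (y″ V.*ₗ (y′ V.*ₗ u)))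
      ≈⟨ V.+ᴹ-assoc _ _ _ ⟨
    ((x V.*ₗ (x′ V.*ₗ u″)) V.+ᴹ (y″ V.*ₗ (x V.*ₗ u′))) V.+ᴹ (y″ V.*ₗ (y′ V.*ₗ u))
      ≈⟨ V.+ᴹ-cong (V.+ᴹ-congˡ (swap y″ x u′)) (swap y″ y′ u) ⟩
    ((x V.*ₗ (x′ V.*ₗ u″)) V.+ᴹ (x V.*ₗ (y″ V.*ₗ u′))) V.+ᴹ (y′ V.*ₗ (y″ V.*ₗ u))
      ≈⟨ V.+ᴹ-cong (V.*ₗ-distribˡ x _ _) (V.*ₗ-assoc y′ y″ u) ⟨
    (x V.*ₗ ((x′ V.*ₗ u″) V.+ᴹ (y″ V.*ₗ u′))) V.+ᴹ ((y′ K.* y″) V.*ₗ u) ∎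
    where open SetoidReasoning V.≈ᴹ-setoid

------------------------------------------------------------------------
-- The three cases

module Cases {K : Field c ℓ} (A : Algebra K a ℓa) where
  open Algebra A

  ｛_｝ : Carrier → Pred Carrier ℓa
  ｛ x ｝ = _≈ x

  infixl 7 _·_
  _·_ : Pred Carrier p → Pred Carrier q → Pred Carrier (c ⊔ a ⊔ ℓa ⊔ p ⊔ q)
  X · Y = Span {M = leftModule} λ z → ∃[ x ] ∃[ y ] x ∈ X × y ∈ Y × z ≈ (x * y)

  k∙_ : Carrier → Subspace leftModule
  k∙ x = Line leftModule x

  CaseI : Set (c ⊔ ℓ ⊔ a ⊔ ℓa)
  CaseI = ∃[ x ] ∃[ y ]
    Dim≥ (asModule ((k∙ 1#) +ˢ (k∙ x) +ˢ (k∙ y) +ˢ (k∙ (x * y)))) 4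

  CaseII : Set (suc (c ⊔ ℓ ⊔ a ⊔ ℓa))
  CaseII = Σ[ V ∈ Subspace leftModule ]
    IsDirectSum ((k∙ 1#) ∷ V ∷ [])
    × (members V · members V) ≐ ｛ 0# ｝

  record IsPeirceTriple (V : Subspace leftModule) (e f : Carrier)
                        : Set (c ⊔ ℓ ⊔ a ⊔ ℓa) where
    field
      directSum : IsDirectSum ((k∙ e) ∷ (k∙ f) ∷ V ∷ [])
      VV≐0      : (members V · members V) ≐ ｛ 0# ｝
      eV≐0      : (｛ e ｝ · members V) ≐ ｛ 0# ｝
      Vf≐0      : (members V · ｛ f ｝) ≐ ｛ 0# ｝
      e²≈e      : (e * e) ≈ e
      f²≈f      : (f * f) ≈ f
      ef≈0      : (e * f) ≈ 0#
      fe≈0      : (f * e) ≈ 0#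
      e+f≈1     : (e + f) ≈ 1#

  CaseIII : Set (suc (c ⊔ ℓ ⊔ a ⊔ ℓa))
  CaseIII = Σ[ V ∈ Subspace leftModule ] ∃[ e ] ∃[ f ] IsPeirceTriple V e f

  -- "Equivalently": a decomposition with subspace V makes A isomorphic to
  -- the triangular algebra on that same V, and an isomorphism of A with the
  -- triangular algebra on any vector space yields a decomposition.
  CaseIII⇔Triangular : Set (suc (c ⊔ ℓ ⊔ a ⊔ ℓa))
  CaseIII⇔Triangular =
    (∀ V e f → IsPeirceTriple V e f → A ≅ Triangular K (asModule V))
    × ((W : LeftModule (Field.ring K) (c ⊔ ℓ ⊔ a ⊔ ℓa) ℓa) →
       A ≅ Triangular K W → CaseIII)

{-# OPTIONS --safe #-}
-- If (i) fails, xy ∈ k1 + kx + ky whenever 1, x, y are linearly independent.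
-- Hence left multiplication by x ∉ k1 induces a map A → A / (k1 + kx) with
-- respect to which every vector is an eigenvector, so it is a scalar L(x). As
-- dim A ≥ 4, comparing the actions of x, y, x + y and xy on a vector outside a
-- suitable three-dimensional subspace shows that L : A → k is an algebra
-- homomorphism, and right multiplication likewise gives R : A → k. For x ∈ M =
-- ker L and y ∈ N = ker R the product xy lies in kx and in ky, and this forces
-- xy = 0. If M ⊆ N, then A = k1 ⊕ M is case (ii). Otherwise choose e ∈ M with
-- R(e) = 1 and put f = 1 − e ∈ N: now ef = 0 makes e and f orthogonal
-- idempotents, and V = M ∩ N gives case (iii). Conversely, in cases (ii) and
-- (iii) any x, y admit scalars k, l with (x − k)(y − l) = 0, which excludes
-- (i).

module Submission where

open import Defs
open import Level using (Level; _⊔_; Lift; lift; lower)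
open import Algebra.Bundles using (CommutativeMonoid)
open import Algebra.Morphism.Structures using (module RingMorphisms)
open import Algebra.Module.Bundles using (LeftModule)
import Algebra.Definitions.RawMonoid as RawSum
import Algebra.Construct.Flip.Op as Op
import Algebra.Properties.AbelianGroup as AbelianGroupProps
import Algebra.Properties.CommutativeSemigroup as CommSemigroupProps
open import Axiom.ExcludedMiddle using (ExcludedMiddle)
open import Data.Fin.Base using (zero; suc)
open import Data.Fin.Patterns using (0F; 1F; 2F)
open import Data.Nat.Base using (ℕ; zero; suc)
open import Data.Product.Base using (∃-syntax; Σ-syntax; _×_; _,_; proj₁; proj₂)
open import Data.Sum.Base using (_⊎_; inj₁; inj₂)
open import Data.Vec.Functional using (Vector; []; _∷_; head; tail)
open import Function.Base using (_∘_)
open import Relation.Binary.Bundles using (Setoid)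
import Relation.Binary.Reasoning.Setoid as SetoidReasoning
open import Relation.Nullary.Decidable using (Dec; yes; no; map′; decidable-stable)
open import Relation.Nullary.Negation using (¬_; contradiction)
open import Relation.Binary.PropositionalEquality.Core as ≡ using (_≡_)
open import Relation.Unary using (Pred; _∈_; _≐_)

-- Subspaces of a vector space

module LinearAlgebra
  {c ℓ m ℓm : Level} (em : ExcludedMiddle (c ⊔ ℓ ⊔ m ⊔ ℓm))
  (K : Field c ℓ) (M : LeftModule (Field.ring K) m ℓm) where

  private module K = Field K
  open LeftModule M
  open RawSum +ᴹ-rawMonoid using (sum)
  open import Algebra.Solver.CommutativeMonoid +ᴹ-commutativeMonoid
    using (solve; _⊜_) renaming (_⊕_ to _:+_)

  private
    Space = Subspace M
    variable
      S T   : Space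
      k l   : K.Carrier
      u v w : Carrierᴹ
      x y z : Carrierᴹ

  0ˢ : Space
  0ˢ = record
    { members   = λ x → Lift (c ⊔ ℓ ⊔ m ⊔ ℓm) (x ≈ᴹ 0ᴹ)
    ; resp-≈    = λ x≈y (lift x≈0) → lift (≈ᴹ-trans (≈ᴹ-sym x≈y) x≈0)
    ; 0-closed  = lift ≈ᴹ-refl
    ; +-closed  = λ (lift x≈0) (lift y≈0) →
        lift (≈ᴹ-trans (+ᴹ-cong x≈0 y≈0) (+ᴹ-identityˡ 0ᴹ))
    ; *ₗ-closed = λ k (lift x≈0) → lift (≈ᴹ-trans (*ₗ-congˡ x≈0) (*ₗ-zeroʳ k))
    }

  -- A record rather than the predicate itself, so that the subspace can be
  -- inferred from a membership.
  infix 4 _∈ˢ_ _∉ˢ_ _⊆ˢ_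
  record _∈ˢ_ (x : Carrierᴹ) (S : Space) : Set (c ⊔ ℓ ⊔ m ⊔ ℓm) where
    constructor ⟨_⟩
    field holds : x ∈ members S
  open _∈ˢ_ public

  _∉ˢ_ : Carrierᴹ → Space → Set (c ⊔ ℓ ⊔ m ⊔ ℓm)
  x ∉ˢ S = ¬ x ∈ˢ S

  _⊆ˢ_ : Space → Space → Set (c ⊔ ℓ ⊔ m ⊔ ℓm)
  S ⊆ˢ T = ∀ {x} → x ∈ˢ S → x ∈ˢ T

  ∈ˢ-resp-≈ : x ≈ᴹ y → x ∈ˢ S → y ∈ˢ S
  ∈ˢ-resp-≈ {S = S} x≈y ⟨ x∈S ⟩ = ⟨ resp-≈ S x≈y x∈S ⟩

  0∈ˢ : 0ᴹ ∈ˢ S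
  0∈ˢ {S} = ⟨ 0-closed S ⟩

  +-∈ˢ : x ∈ˢ S → y ∈ˢ S → x +ᴹ y ∈ˢ S
  +-∈ˢ {S = S} ⟨ x∈S ⟩ ⟨ y∈S ⟩ = ⟨ +-closed S x∈S y∈S ⟩

  *ₗ-∈ˢ : ∀ k → x ∈ˢ S → k *ₗ x ∈ˢ S
  *ₗ-∈ˢ {S = S} k ⟨ x∈S ⟩ = ⟨ *ₗ-closed S k x∈S ⟩

  -ᴹ-∈ˢ : x ∈ˢ S → -ᴹ x ∈ˢ S
  -ᴹ-∈ˢ {S = S} ⟨ x∈S ⟩ = ⟨ -ᴹ-closed S x∈S ⟩

  +-∈ˢ-cancelʳ : x +ᴹ y ∈ˢ S → y ∈ˢ S → x ∈ˢ S
  +-∈ˢ-cancelʳ {x = x} {y = y} x+y∈S y∈S =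
    ∈ˢ-resp-≈ (≈ᴹ-trans (+ᴹ-assoc x y (-ᴹ y))
                (≈ᴹ-trans (+ᴹ-congˡ (-ᴹ‿inverseʳ y)) (+ᴹ-identityʳ x)))
      (+-∈ˢ x+y∈S (-ᴹ-∈ˢ y∈S))

  -- Congruence modulo a subspace

  infix 4 _≈_mod_
  _≈_mod_ : Carrierᴹ → Carrierᴹ → Space → Set (c ⊔ ℓ ⊔ m ⊔ ℓm)
  x ≈ y mod S = ∃[ u ] u ∈ˢ S × x ≈ᴹ u +ᴹ y

  mod-reflexive : x ≈ᴹ y → x ≈ y mod S
  mod-reflexive x≈y =
    0ᴹ , 0∈ˢ , ≈ᴹ-trans x≈y (≈ᴹ-sym (+ᴹ-identityˡ _))

  mod-sym : x ≈ y mod S → y ≈ x mod S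
  mod-sym {x = x} {y = y} (u , u∈S , x≈u+y) = -ᴹ u , -ᴹ-∈ˢ u∈S , (begin
    y                   ≈⟨ +ᴹ-identityˡ y ⟨
    0ᴹ +ᴹ y             ≈⟨ +ᴹ-congʳ (-ᴹ‿inverseˡ u) ⟨
    -ᴹ u +ᴹ u +ᴹ y      ≈⟨ +ᴹ-assoc _ _ _ ⟩
    -ᴹ u +ᴹ (u +ᴹ y)    ≈⟨ +ᴹ-congˡ x≈u+y ⟨
    -ᴹ u +ᴹ x           ∎)
    where open SetoidReasoning ≈ᴹ-setoid

  mod-trans : x ≈ y mod S → y ≈ z mod S → x ≈ z mod S
  mod-trans (u , u∈S , x≈u+y) (v , v∈S , y≈v+z) =
    u +ᴹ v , +-∈ˢ u∈S v∈S ,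
    ≈ᴹ-trans x≈u+y (≈ᴹ-trans (+ᴹ-congˡ y≈v+z) (≈ᴹ-sym (+ᴹ-assoc _ _ _)))

  mod-setoid : Space → Setoid m (c ⊔ ℓ ⊔ m ⊔ ℓm)
  mod-setoid S = record
    { Carrier       = Carrierᴹ
    ; _≈_           = λ x y → x ≈ y mod S
    ; isEquivalence = record
      { refl  = mod-reflexive ≈ᴹ-refl
      ; sym   = mod-sym
      ; trans = mod-trans
      }
    }

  mod-+-cong : x ≈ y mod S → u ≈ v mod S → x +ᴹ u ≈ y +ᴹ v mod S
  mod-+-cong {y = y} {v = v} (a , a∈S , x≈a+y) (b , b∈S , u≈b+v) =
    a +ᴹ b , +-∈ˢ a∈S b∈S ,
    ≈ᴹ-trans (+ᴹ-cong x≈a+y u≈b+v)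
      (solve 4 (λ a y b v → (a :+ y) :+ (b :+ v) ⊜ (a :+ b) :+ (y :+ v))
        ≈ᴹ-refl a y b v)

  mod-*ₗ-cong : x ≈ y mod S → k *ₗ x ≈ k *ₗ y mod S
  mod-*ₗ-cong {k = k} (u , u∈S , x≈u+y) =
    k *ₗ u , *ₗ-∈ˢ k u∈S , ≈ᴹ-trans (*ₗ-congˡ x≈u+y) (*ₗ-distribˡ k _ _)

  mod-mono : S ⊆ˢ T → x ≈ y mod S → x ≈ y mod T
  mod-mono S⊆T (u , u∈S , x≈u+y) = u , S⊆T u∈S , x≈u+y

  ∈⇒mod : x ∈ˢ S → x ≈ 0ᴹ mod S
  ∈⇒mod x∈S = _ , x∈S , ≈ᴹ-sym (+ᴹ-identityʳ _)

  mod-∈ : x ≈ y mod S → y ∈ˢ S → x ∈ˢ S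
  mod-∈ (u , u∈S , x≈u+y) y∈S = ∈ˢ-resp-≈ (≈ᴹ-sym x≈u+y) (+-∈ˢ u∈S y∈S)

  mod-+-cancelʳ : x +ᴹ u ≈ y +ᴹ u mod S → x ≈ y mod S
  mod-+-cancelʳ {x = x} {u = u} {y = y} {S = S} x+u≈y+u = begin
    x                    ≈⟨ cancel x ⟨
    x +ᴹ u +ᴹ -ᴹ u       ≈⟨ mod-+-cong x+u≈y+u (mod-reflexive ≈ᴹ-refl) ⟩
    y +ᴹ u +ᴹ -ᴹ u       ≈⟨ cancel y ⟩
    y                    ∎
    where
    open SetoidReasoning (mod-setoid S)
    cancel : ∀ x → x +ᴹ u +ᴹ -ᴹ u ≈ x mod S
    cancel x = mod-reflexive (≈ᴹ-trans (+ᴹ-assoc _ _ _)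
      (≈ᴹ-trans (+ᴹ-congˡ (-ᴹ‿inverseʳ u)) (+ᴹ-identityʳ x)))

  -- Excluded middle is assumed at one level only, to which a scalar equation has to be lifted.
  isZero? : ∀ k → Dec (k K.≈ K.0#)
  isZero? k = map′ lower lift (em {Lift (c ⊔ ℓ ⊔ m ⊔ ℓm) (k K.≈ K.0#)})

  ∈-dec : ∀ S x → Dec (x ∈ˢ S)
  ∈-dec S x = em

  unscale : ¬ (k K.≈ K.0#) → k *ₗ x ∈ˢ S → x ∈ˢ S
  unscale {k = k} {x = x} k≉0 kx∈S = ∈ˢ-resp-≈ (begin
    k⁻¹ *ₗ (k *ₗ x)     ≈⟨ *ₗ-assoc k⁻¹ k x ⟨
    (k⁻¹ K.* k) *ₗ x    ≈⟨ *ₗ-congʳ (proj₁ (proj₂ (K.invertible k k≉0))) ⟩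
    K.1# *ₗ x           ≈⟨ *ₗ-identityˡ x ⟩
    x                   ∎) (*ₗ-∈ˢ k⁻¹ kx∈S)
    where
    open SetoidReasoning ≈ᴹ-setoid
    k⁻¹ = proj₁ (K.invertible k k≉0)

  coefficient-zero : x ∉ˢ S → k *ₗ x ∈ˢ S → k K.≈ K.0#
  coefficient-zero {k = k} x∉S kx∈S with isZero? k
  ... | yes k≈0 = k≈0
  ... | no  k≉0 = contradiction (unscale k≉0 kx∈S) x∉S

  -- The class of `x` modulo `S` is a nonzero vector, so its scalar can be read off. Eigenvalues in
  -- quotients are compared in this way.
  coefficient-unique : x ∉ˢ S → k *ₗ x ≈ l *ₗ x mod S → k K.≈ l
  coefficient-unique {x = x} {S = S} {k = k} {l = l} x∉S kx≈lx =
    KP.x∙y⁻¹≈ε⇒x≈y k l (coefficient-zero x∉S (mod-∈ (begin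
      (k K.+ K.- l) *ₗ x             ≈⟨ mod-reflexive (*ₗ-distribʳ x k (K.- l)) ⟩
      k *ₗ x +ᴹ (K.- l) *ₗ x         ≈⟨ mod-+-cong kx≈lx (mod-reflexive ≈ᴹ-refl) ⟩
      l *ₗ x +ᴹ (K.- l) *ₗ x         ≈⟨ mod-reflexive (*ₗ-distribʳ x l (K.- l)) ⟨
      (l K.+ K.- l) *ₗ x             ≈⟨ mod-reflexive (*ₗ-congʳ (K.-‿inverseʳ l)) ⟩
      K.0# *ₗ x                      ≈⟨ mod-reflexive (*ₗ-zeroˡ x) ⟩
      0ᴹ                             ∎) 0∈ˢ))
    where
    open SetoidReasoning (mod-setoid S)
    module KP = AbelianGroupProps K.+-abelianGroup

  Line-least : x ∈ˢ T → Line M x ⊆ˢ T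
  Line-least x∈T ⟨ k , lift y≈kx ⟩ = ∈ˢ-resp-≈ (≈ᴹ-sym y≈kx) (*ₗ-∈ˢ k x∈T)

  ∈-Line : x ∈ˢ Line M x
  ∈-Line = ⟨ K.1# , lift (≈ᴹ-sym (*ₗ-identityˡ _)) ⟩

  infixl 6 _+k_
  -- Opaque because the unfolded sum does not determine its summands as
  -- records, so that unification could not recover S from S +k x.
  opaque
    _+k_ : Space → Carrierᴹ → Space
    S +k x = S +ˢ Line M x

    +k-unfold : S +k x ≡ S +ˢ Line M x
    +k-unfold = ≡.refl

    +k⇒mod : y ∈ˢ S +k x → ∃[ k ] (y ≈ k *ₗ x mod S)
    +k⇒mod ⟨ u , w , u∈S , (k , lift w≈kx) , y≈u+w ⟩ =
      k , u , ⟨ u∈S ⟩ , ≈ᴹ-trans y≈u+w (+ᴹ-congˡ w≈kx)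

    mod⇒+k : ∀ k → y ≈ k *ₗ x mod S → y ∈ˢ S +k x
    mod⇒+k k (u , ⟨ u∈S ⟩ , y≈u+kx) = ⟨ u , _ , u∈S , (k , lift ≈ᴹ-refl) , y≈u+kx ⟩

  +k-least : S ⊆ˢ T → x ∈ˢ T → S +k x ⊆ˢ T
  +k-least S⊆T x∈T y∈S+kx with +k⇒mod y∈S+kx
  ... | k , u , u∈S , y≈u+kx =
    ∈ˢ-resp-≈ (≈ᴹ-sym y≈u+kx) (+-∈ˢ (S⊆T u∈S) (*ₗ-∈ˢ k x∈T))

  ⊆-+k : S ⊆ˢ S +k x
  ⊆-+k u∈S = mod⇒+k K.0# (_ , u∈S ,
    ≈ᴹ-sym (≈ᴹ-trans (+ᴹ-congˡ (*ₗ-zeroˡ _)) (+ᴹ-identityʳ _)))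

  ∈-+k : x ∈ˢ S +k x
  ∈-+k = mod⇒+k K.1# (mod-reflexive (≈ᴹ-sym (*ₗ-identityˡ _)))

  +k-mono : S ⊆ˢ T → S +k x ⊆ˢ T +k x
  +k-mono S⊆T = +k-least (⊆-+k ∘ S⊆T) ∈-+k

  +k-swap : S +k x +k y ⊆ˢ S +k y +k x
  +k-swap = +k-least (+k-least (⊆-+k ∘ ⊆-+k) ∈-+k) (⊆-+k ∈-+k)

  -- The coefficient of `x` in `y` cannot vanish, as `y` would then lie in `S`; so it can be
  -- inverted modulo `S +k y`.
  exchange : y ∈ˢ S +k x → y ∉ˢ S → x ∈ˢ S +k y
  exchange {y = y} {x = x} y∈S+kx y∉S with +k⇒mod y∈S+kx
  ... | k , y≈kx = unscale k≉0
    (mod-∈ (mod-mono ⊆-+k (mod-sym y≈kx)) ∈-+k)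
    where
    k≉0 : ¬ (k K.≈ K.0#)
    k≉0 k≈0 = y∉S (mod-∈ y≈kx
      (∈ˢ-resp-≈ (≈ᴹ-sym (≈ᴹ-trans (*ₗ-congʳ k≈0) (*ₗ-zeroˡ x))) 0∈ˢ))

  -- Dimension

  -- Linear independence of the classes of `v` in the quotient by `S`. Carrying `S` along spares the
  -- inductions the formation of quotients.
  IndependentOver : ∀ {n} → Space → Vector Carrierᴹ n → Set (c ⊔ ℓ ⊔ m ⊔ ℓm)
  IndependentOver {n} S v = ∀ (k : Vector K.Carrier n) →
    sum (λ i → k i *ₗ v i) ∈ˢ S → ∀ i → k i K.≈ K.0#

  -- An upper bound `n` for the dimension of `T` modulo `S`; the adjoined vectors may lie outside
  -- `T`. The recursion enlarges `S`, as `independent-tail` does.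
  SpannedOver : ℕ → Space → Space → Set (c ⊔ ℓ ⊔ m ⊔ ℓm)
  SpannedOver zero    S T = T ⊆ˢ S
  SpannedOver (suc n) S T = ∃[ x ] SpannedOver n (S +k x) T

  SpannedOver-mono : ∀ n {S S′ : Space} → S ⊆ˢ S′ →
                     SpannedOver n S T → SpannedOver n S′ T
  SpannedOver-mono zero    S⊆S′ T⊆S         = S⊆S′ ∘ T⊆S
  SpannedOver-mono (suc n) S⊆S′ (x , span) =
    x , SpannedOver-mono n (+k-mono S⊆S′) span

  -- `v` replaces the first adjoined vector whose addition brings `v` into the space; the earlier
  -- ones are kept and `v` is moved past them. Such a vector exists because `v` lies in `T`.
  SpannedOver-exchange : ∀ n S → SpannedOver (suc n) S T →
    v ∈ˢ T → v ∉ˢ S → SpannedOver n (S +k v) T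
  SpannedOver-exchange {v = v} n S (x , span) v∈T v∉S with ∈-dec (S +k x) v
  ... | yes v∈S+kx = SpannedOver-mono n
    (+k-least ⊆-+k (exchange v∈S+kx v∉S)) span
  SpannedOver-exchange zero S (x , T⊆S+kx) v∈T v∉S | no v∉S+kx =
    contradiction (T⊆S+kx v∈T) v∉S+kx
  SpannedOver-exchange (suc n) S (x , span) v∈T v∉S | no v∉S+kx =
    x , SpannedOver-mono n (+k-swap)
          (SpannedOver-exchange n (S +k x) span v∈T v∉S+kx)

  sum-zero : ∀ n (k : Vector K.Carrier n) (v : Vector Carrierᴹ n) → (∀ i → k i K.≈ K.0#) →
             sum (λ i → k i *ₗ v i) ≈ᴹ 0ᴹ
  sum-zero zero    k v k≈0 = ≈ᴹ-refl
  sum-zero (suc n) k v k≈0 = ≈ᴹ-trans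
    (+ᴹ-cong (≈ᴹ-trans (*ₗ-congʳ (k≈0 zero)) (*ₗ-zeroˡ (head v)))
             (sum-zero n (tail k) (tail v) (k≈0 ∘ suc)))
    (+ᴹ-identityˡ 0ᴹ)

  independent-head : ∀ {n} S (v : Vector Carrierᴹ (suc n)) →
                     IndependentOver S v → head v ∉ˢ S
  independent-head {n} S v ind v₀∈S = K.1≉0
    (ind (K.1# ∷ λ _ → K.0#) (∈ˢ-resp-≈ (≈ᴹ-sym sum≈v₀) v₀∈S) zero)
    where
    sum≈v₀ : K.1# *ₗ head v +ᴹ sum (λ i → K.0# *ₗ tail v i) ≈ᴹ head v
    sum≈v₀ = ≈ᴹ-trans
      (+ᴹ-cong (*ₗ-identityˡ (head v)) (sum-zero n (λ _ → K.0#) (tail v) (λ _ → K.refl)))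
      (+ᴹ-identityʳ (head v))

  independent-tail : ∀ {n} S (v : Vector Carrierᴹ (suc n)) →
    IndependentOver S v → IndependentOver (S +k head v) (tail v)
  independent-tail S v ind k sum∈ i with +k⇒mod sum∈
  -- Moving `l *ₗ v₀` to the other side gives a relation over `S` for all of `v`, with head
  -- coefficient -l.
  ... | l , u , u∈S , sum≈u+lv₀ = ind (K.- l ∷ k) (∈ˢ-resp-≈ (≈ᴹ-sym (begin
      (K.- l) *ₗ v₀ +ᴹ sum (λ i → k i *ₗ tail v i)  ≈⟨ +ᴹ-congˡ sum≈u+lv₀ ⟩
      (K.- l) *ₗ v₀ +ᴹ (u +ᴹ l *ₗ v₀)
        ≈⟨ solve 3 (λ a u b → a :+ (u :+ b) ⊜ (a :+ b) :+ u) ≈ᴹ-refl _ u _ ⟩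
      (K.- l) *ₗ v₀ +ᴹ l *ₗ v₀ +ᴹ u                 ≈⟨ +ᴹ-congʳ (*ₗ-distribʳ v₀ _ _) ⟨
      (K.- l K.+ l) *ₗ v₀ +ᴹ u                      ≈⟨ +ᴹ-congʳ (*ₗ-congʳ (K.-‿inverseˡ l)) ⟩
      K.0# *ₗ v₀ +ᴹ u                               ≈⟨ +ᴹ-congʳ (*ₗ-zeroˡ v₀) ⟩
      0ᴹ +ᴹ u                                       ≈⟨ +ᴹ-identityˡ u ⟩
      u                                             ∎)) u∈S) (suc i)
    where
    open SetoidReasoning ≈ᴹ-setoid
    v₀ = head v

  independent-[] : ∀ S (v : Vector Carrierᴹ 0) → IndependentOver S v
  independent-[] S v k sum∈S ()

  -- A relation over `S` is one for the tail over `S +k head v`. Hence the tail coefficients vanish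
  -- first, and what remains is a multiple of the head in `S`.
  independent-∷ : ∀ {n} S (v : Vector Carrierᴹ (suc n)) → head v ∉ˢ S →
    IndependentOver (S +k head v) (tail v) → IndependentOver S v
  independent-∷ {n} S v v₀∉S ind k sum∈S = λ
    { zero    → coefficient-zero v₀∉S (∈ˢ-resp-≈ k₀v₀≈ sum∈S)
    ; (suc i) → tail≈0 i
    }
    where
    open SetoidReasoning ≈ᴹ-setoid
    v₀   = head v
    rest = sum (λ i → tail k i *ₗ tail v i)

    rest∈ : rest ∈ˢ S +k v₀
    rest∈ = ∈ˢ-resp-≈ (begin
      (K.- head k) *ₗ v₀ +ᴹ (head k *ₗ v₀ +ᴹ rest)  ≈⟨ +ᴹ-assoc _ _ _ ⟨
      (K.- head k) *ₗ v₀ +ᴹ head k *ₗ v₀ +ᴹ rest    ≈⟨ +ᴹ-congʳ (*ₗ-distribʳ v₀ _ _) ⟨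
      (K.- head k K.+ head k) *ₗ v₀ +ᴹ rest
        ≈⟨ +ᴹ-congʳ (≈ᴹ-trans (*ₗ-congʳ (K.-‿inverseˡ (head k))) (*ₗ-zeroˡ v₀)) ⟩
      0ᴹ +ᴹ rest                                    ≈⟨ +ᴹ-identityˡ rest ⟩
      rest                                          ∎)
      (+-∈ˢ (*ₗ-∈ˢ (K.- head k) ∈-+k) (⊆-+k sum∈S))

    tail≈0 = ind (tail k) rest∈

    k₀v₀≈ : head k *ₗ v₀ +ᴹ rest ≈ᴹ head k *ₗ v₀
    k₀v₀≈ = ≈ᴹ-trans (+ᴹ-congˡ (sum-zero n (tail k) (tail v) tail≈0))
      (+ᴹ-identityʳ _)

  -- The head of `v` is exchanged for one spanning vector, and over `S +k head v` both counts drop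
  -- by one. When no spanning vector is left, the head lies in `S`, against independence.
  steinitz : ∀ n S T (v : Vector Carrierᴹ (suc n)) → IndependentOver S v →
             (∀ i → v i ∈ˢ T) → ¬ SpannedOver n S T
  steinitz zero    S T v ind v∈T T⊆S  = independent-head S v ind (T⊆S (v∈T zero))
  steinitz (suc n) S T v ind v∈T span =
    steinitz n (S +k head v) T (tail v) (independent-tail S v ind) (v∈T ∘ suc)
      (SpannedOver-exchange n S span (v∈T zero) (independent-head S v ind))

  -- By `steinitz` an independent family of this size cannot lie inside `T`.
  dim≥⇒∃∉ : ∀ n → Dim≥ M (suc n) → ∀ T → SpannedOver n 0ˢ T → ∃[ z ] z ∉ˢ T
  dim≥⇒∃∉ n (v , ind) T span = decidable-stable em λ ¬∃ →
    steinitz n 0ˢ T v (λ k sum∈0 → ind k (lower (holds sum∈0)))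
      (λ i → decidable-stable (∈-dec T (v i)) λ v∉T → ¬∃ (v i , v∉T)) span

  -- Dimension of a subspace regarded as a module of its own

  module _ (T : Space) where
    private module T = LeftModule (asModule T)
    open RawSum T.+ᴹ-rawMonoid using () renaming (sum to sumᵀ)

    sum-proj₁ : ∀ n (v : Vector T.Carrierᴹ n) → proj₁ (sumᵀ v) ≡ sum (proj₁ ∘ v)
    sum-proj₁ zero    v = ≡.refl
    sum-proj₁ (suc n) v = ≡.cong (proj₁ (head v) +ᴹ_) (sum-proj₁ n (tail v))

    independent-asModule⁺ : ∀ {n} (v : Vector T.Carrierᴹ n) →
      IndependentOver 0ˢ (proj₁ ∘ v) → LinearlyIndependent (asModule T) v
    independent-asModule⁺ v ind k sum≈0 =
      ind k ⟨ lift (≡.subst (_≈ᴹ 0ᴹ) (sum-proj₁ _ (λ i → k i T.*ₗ v i)) sum≈0) ⟩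

    independent-asModule⁻ : ∀ {n} (v : Vector T.Carrierᴹ n) →
      LinearlyIndependent (asModule T) v → IndependentOver 0ˢ (proj₁ ∘ v)
    independent-asModule⁻ v ind k sum∈0 = ind k
      (≡.subst (_≈ᴹ 0ᴹ) (≡.sym (sum-proj₁ _ (λ i → k i T.*ₗ v i)))
        (lower (holds sum∈0)))

    dim≥-asModule : ∀ n → Dim≥ (asModule T) (suc n) → ¬ SpannedOver n 0ˢ T
    dim≥-asModule n (v , ind) =
      steinitz n 0ˢ T (proj₁ ∘ v) (independent-asModule⁻ v ind) (λ i → ⟨ proj₂ (v i) ⟩)

  -- Linear forms with value 1 at a vector, and the splitting along it

  record UnitalForm (u : Carrierᴹ) : Set (c ⊔ ℓ ⊔ m ⊔ ℓm) where
    field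
      ⟦_⟧     : Carrierᴹ → K.Carrier
      ⟦⟧-cong : x ≈ᴹ y → ⟦ x ⟧ K.≈ ⟦ y ⟧
      +-homo  : ∀ x y → ⟦ x +ᴹ y ⟧ K.≈ ⟦ x ⟧ K.+ ⟦ y ⟧
      *ₗ-homo : ∀ k x → ⟦ k *ₗ x ⟧ K.≈ k K.* ⟦ x ⟧
      1-homo  : ⟦ u ⟧ K.≈ K.1#

    0-homo : ⟦ 0ᴹ ⟧ K.≈ K.0#
    0-homo = K.trans (⟦⟧-cong (≈ᴹ-sym (*ₗ-zeroˡ 0ᴹ)))
      (K.trans (*ₗ-homo K.0# 0ᴹ) (K.zeroˡ _))

    -‿homo : ∀ x → ⟦ -ᴹ x ⟧ K.≈ K.- ⟦ x ⟧
    -‿homo x = AbelianGroupProps.inverseˡ-unique K.+-abelianGroup _ _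
      (K.trans (K.sym (+-homo (-ᴹ x) x))
        (K.trans (⟦⟧-cong (-ᴹ‿inverseˡ x)) 0-homo))

    kernel : Space
    kernel = record
      { members   = λ x → Lift (c ⊔ ℓ ⊔ m ⊔ ℓm) (⟦ x ⟧ K.≈ K.0#)
      ; resp-≈    = λ x≈y (lift x≈0) → lift (K.trans (⟦⟧-cong (≈ᴹ-sym x≈y)) x≈0)
      ; 0-closed  = lift 0-homo
      ; +-closed  = λ {x} {y} (lift x≈0) (lift y≈0) →
          lift (K.trans (+-homo x y) (K.trans (K.+-cong x≈0 y≈0) (K.+-identityˡ K.0#)))
      ; *ₗ-closed = λ k {x} (lift x≈0) →
          lift (K.trans (*ₗ-homo k x) (K.trans (K.*-congˡ x≈0) (K.zeroʳ k)))
      }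

    ⟦⟧-difference : ⟦ x ⟧ K.≈ ⟦ y ⟧ → ⟦ x +ᴹ -ᴹ y ⟧ K.≈ K.0#
    ⟦⟧-difference {x = x} {y = y} x≈y = begin
      ⟦ x +ᴹ -ᴹ y ⟧        ≈⟨ +-homo x (-ᴹ y) ⟩
      ⟦ x ⟧ K.+ ⟦ -ᴹ y ⟧   ≈⟨ K.+-cong x≈y (-‿homo y) ⟩
      ⟦ y ⟧ K.+ K.- ⟦ y ⟧  ≈⟨ K.-‿inverseʳ ⟦ y ⟧ ⟩
      K.0#                 ∎
      where open SetoidReasoning K.setoid

    ⟦*ₗu⟧ : ∀ k → ⟦ k *ₗ u ⟧ K.≈ k
    ⟦*ₗu⟧ k = K.trans (*ₗ-homo k u) (K.trans (K.*-congˡ 1-homo) (K.*-identityʳ k))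

    -- The projection onto the kernel along u.
    π : Carrierᴹ → Carrierᴹ
    π x = x +ᴹ -ᴹ (⟦ x ⟧ *ₗ u)

    ⟦π⟧≈0 : ∀ x → ⟦ π x ⟧ K.≈ K.0#
    ⟦π⟧≈0 x = ⟦⟧-difference (K.sym (⟦*ₗu⟧ ⟦ x ⟧))

-- The scalar by which left multiplication acts, as a linear form

module EigenvalueForm
  {c ℓ a ℓa : Level} (em : ExcludedMiddle (c ⊔ ℓ ⊔ a ⊔ ℓa))
  (K : Field c ℓ) (A : Algebra K a ℓa) where

  private module K = Field K
  open Algebra A
  open LeftModule leftModule
    using (*ₗ-congˡ; *ₗ-congʳ; *ₗ-distribˡ; *ₗ-distribʳ; *ₗ-assoc)
  open LinearAlgebra em K leftModule
  open Cases A using (k∙_)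

  -- Modulo k1 + kx, left multiplication by x has every vector as an
  -- eigenvector, hence is a scalar.  This also forces x² ∈ k1 + kx, as the
  -- map is defined on all of A.
  module _
    (∃∉ : ∀ x y → ∃[ z ] z ∉ˢ k∙ 1# +k x +k y)
    (xy∈ : ∀ {x y} → x ∉ˢ k∙ 1# → y ∉ˢ k∙ 1# +k x → x * y ∈ˢ k∙ 1# +k x +k y)
    where

    ActsBy : Carrier → K.Carrier → Set (c ⊔ ℓ ⊔ a ⊔ ℓa)
    ActsBy x γ = ∀ y → x * y ≈ γ *ₗ y mod (k∙ 1# +k x)

    module _ {x} (x∉k : x ∉ˢ k∙ 1#) where
      private
        S = k∙ 1# +k x

      eigenvalue : ∀ {y} → y ∉ˢ S → ∃[ γ ] (x * y ≈ γ *ₗ y mod S)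
      eigenvalue y∉S = +k⇒mod (xy∈ x∉k y∉S)

      -- The sum `y + z` is an eigenvector too, with value `ε` say. Modulo `S +k z` the multiples of
      -- `z` vanish, which gives `δ` = `ε`; cancelling the multiples of `y` modulo `S` then gives
      -- `γ` = `ε`.
      eigenvalue-unique : ∀ {y z γ δ} → z ∉ˢ S → y ∉ˢ S +k z →
        x * z ≈ γ *ₗ z mod S → x * y ≈ δ *ₗ y mod S → δ K.≈ γ
      eigenvalue-unique {y} {z} {γ} {δ} z∉S y∉S+kz xz≈γz xy≈δy
        with eigenvalue {y + z} (λ y+z∈S → y∉S+kz (+-∈ˢ-cancelʳ (⊆-+k y+z∈S) ∈-+k))
      ... | ε , x[y+z]≈ε[y+z] = K.trans δ≈ε (K.sym γ≈ε)
        where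
        -- The chains below work modulo `S` or modulo `S +k z`, so the reasoning is generic in the
        -- subspace.
        open module RS {S} = SetoidReasoning (mod-setoid S)
        combined : δ *ₗ y + γ *ₗ z ≈ ε *ₗ y + ε *ₗ z mod S
        combined = begin
          δ *ₗ y + γ *ₗ z    ≈⟨ mod-+-cong xy≈δy xz≈γz ⟨
          x * y + x * z      ≈⟨ mod-reflexive (distribˡ x y z) ⟨
          x * (y + z)        ≈⟨ x[y+z]≈ε[y+z] ⟩
          ε *ₗ (y + z)       ≈⟨ mod-reflexive (*ₗ-distribˡ ε y z) ⟩
          ε *ₗ y + ε *ₗ z    ∎

        drop : ∀ k u → u ≈ u + k *ₗ z mod (S +k z)
        drop k u = mod-trans (mod-reflexive (sym (+-identityʳ u)))
          (mod-+-cong (mod-reflexive refl) (mod-sym (∈⇒mod (*ₗ-∈ˢ k ∈-+k))))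

        δ≈ε : δ K.≈ ε
        δ≈ε = coefficient-unique y∉S+kz (begin
          δ *ₗ y             ≈⟨ drop γ _ ⟩
          δ *ₗ y + γ *ₗ z    ≈⟨ mod-mono ⊆-+k combined ⟩
          ε *ₗ y + ε *ₗ z    ≈⟨ drop ε _ ⟨
          ε *ₗ y             ∎)

        γ≈ε : γ K.≈ ε
        γ≈ε = coefficient-unique z∉S (mod-+-cancelʳ (begin
          γ *ₗ z + ε *ₗ y    ≈⟨ mod-reflexive (+-congˡ (*ₗ-congʳ δ≈ε)) ⟨
          γ *ₗ z + δ *ₗ y    ≈⟨ mod-reflexive (+-comm _ _) ⟩
          δ *ₗ y + γ *ₗ z    ≈⟨ combined ⟩
          ε *ₗ y + ε *ₗ z    ≈⟨ mod-reflexive (+-comm _ _) ⟩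
          ε *ₗ z + ε *ₗ y    ∎))

    -- The scalar is the eigenvalue `γ` at some `z` outside k1 + kx. By uniqueness every vector
    -- outside k1 + kx + kz shares it, and a vector `y` inside is the difference of two outside
    -- ones, `y + w` and `w`.
    acts : ∀ x → ∃[ γ ] ActsBy x γ
    acts x with ∈-dec (k∙ 1#) x
    ... | yes ⟨ γ , lift x≈γ1 ⟩ = γ , λ y → mod-reflexive
      (trans (*-congʳ x≈γ1) (trans (*ₗ-*-assoc γ 1# y) (*ₗ-congˡ (*-identityˡ y))))
    -- Repeating `x` yields a `z` outside k1 + kx; `w` then avoids k1 + kx + kz.
    ... | no x∉k with ∃∉ x x
    ...   | z , z∉ with ∃∉ x z | eigenvalue x∉k (z∉ ∘ ⊆-+k)
    ...     | w , w∉ | γ , xz≈γz = γ , everywhere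
      where
      S = k∙ 1# +k x

      outside : ∀ y → y ∉ˢ S +k z → x * y ≈ γ *ₗ y mod S
      outside y y∉ with eigenvalue x∉k (y∉ ∘ ⊆-+k)
      ... | δ , xy≈δy = mod-trans xy≈δy (mod-reflexive
        (*ₗ-congʳ (eigenvalue-unique x∉k (z∉ ∘ ⊆-+k) y∉ xz≈γz xy≈δy)))

      everywhere : ActsBy x γ
      everywhere y with ∈-dec (S +k z) y
      ... | no  y∉ = outside y y∉
      ... | yes y∈ = mod-+-cancelʳ (begin
        x * y + x * w      ≈⟨ mod-reflexive (distribˡ x y w) ⟨
        x * (y + w)        ≈⟨ outside (y + w) (λ y+w∈ → w∉
                                (+-∈ˢ-cancelʳ (∈ˢ-resp-≈ (+-comm y w) y+w∈) y∈)) ⟩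
        γ *ₗ (y + w)       ≈⟨ mod-reflexive (*ₗ-distribˡ γ y w) ⟩
        γ *ₗ y + γ *ₗ w    ≈⟨ mod-+-cong (mod-reflexive refl) (outside w w∉) ⟨
        γ *ₗ y + x * w     ∎)
        where open SetoidReasoning (mod-setoid S)

    private
      ⟦_⟧ : Carrier → K.Carrier
      ⟦ x ⟧ = proj₁ (acts x)

      leftPreimage : Carrier → Subspace leftModule → Subspace leftModule
      leftPreimage x S = record
        { members   = λ y → x * y ∈ members S
        ; resp-≈    = λ y≈z → resp-≈ S (*-congˡ y≈z)
        ; 0-closed  = resp-≈ S (sym (zeroʳ x)) (0-closed S)
        ; +-closed  = λ xy∈S xz∈S → resp-≈ S (sym (distribˡ x _ _)) (+-closed S xy∈S xz∈S)
        ; *ₗ-closed = λ k xy∈S → resp-≈ S (sym (*-*ₗ-comm k x _)) (*ₗ-closed S k xy∈S)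
        }

    -- The larger subspace still misses some vector `u`, and the action on `u` determines the
    -- scalar. Thus each law below can be checked modulo one subspace that is convenient for both
    -- sides.
    ⟦⟧-unique : ∀ {x y z γ} → k∙ 1# +k x ⊆ˢ k∙ 1# +k y +k z →
      (∀ u → x * u ≈ γ *ₗ u mod (k∙ 1# +k y +k z)) → ⟦ x ⟧ K.≈ γ
    ⟦⟧-unique {x} {y} {z} ⊆S xu≈γu with ∃∉ y z
    ... | u , u∉S = coefficient-unique u∉S
      (mod-trans (mod-sym (mod-mono ⊆S (proj₂ (acts x) u))) (xu≈γu u))

    -- The scalar is chosen for each representative separately, so its independence of the
    -- representative rests on uniqueness.
    ⟦⟧-cong : ∀ {x y} → x ≈ y → ⟦ x ⟧ K.≈ ⟦ y ⟧
    ⟦⟧-cong {x} {y} x≈y = ⟦⟧-unique {y = x} {z = y} ⊆-+k λ u →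
      mod-trans (mod-reflexive (*-congʳ x≈y))
        (mod-mono (+k-mono ⊆-+k) (proj₂ (acts y) u))

    scalar-homo : ∀ k → ⟦ k *ₗ 1# ⟧ K.≈ k
    scalar-homo k = ⟦⟧-unique {y = k *ₗ 1#} {z = 0#} ⊆-+k λ u →
      mod-reflexive (trans (*ₗ-*-assoc k 1# u) (*ₗ-congˡ (*-identityˡ u)))

    +-homo : ∀ x y → ⟦ x + y ⟧ K.≈ ⟦ x ⟧ K.+ ⟦ y ⟧
    +-homo x y = ⟦⟧-unique {y = x} {z = y}
      (+k-least (⊆-+k ∘ ⊆-+k) (+-∈ˢ (⊆-+k ∈-+k) ∈-+k)) λ u → begin
        (x + y) * u              ≈⟨ mod-reflexive (distribʳ u x y) ⟩
        x * u + y * u            ≈⟨ mod-+-cong (mod-mono ⊆-+k (proj₂ (acts x) u))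
                                      (mod-mono (+k-mono ⊆-+k) (proj₂ (acts y) u)) ⟩
        ⟦ x ⟧ *ₗ u + ⟦ y ⟧ *ₗ u   ≈⟨ mod-reflexive (*ₗ-distribʳ u ⟦ x ⟧ ⟦ y ⟧) ⟨
        (⟦ x ⟧ K.+ ⟦ y ⟧) *ₗ u    ∎
      where open SetoidReasoning (mod-setoid (k∙ 1# +k x +k y))

    -- The subspace is k1 + kx + k(xy), which may miss `y`. Replacing yu by `⟦ y ⟧ *ₗ u` makes an
    -- error in k1 + ky, and multiplying this error by `x` moves it into kx + k(xy).
    *-homo : ∀ x y → ⟦ x * y ⟧ K.≈ ⟦ x ⟧ K.* ⟦ y ⟧
    *-homo x y = ⟦⟧-unique {y = x} {z = x * y} (+k-mono ⊆-+k) λ u → begin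
      (x * y) * u              ≈⟨ mod-reflexive (*-assoc x y u) ⟩
      x * (y * u)              ≈⟨ left-multiple u ⟩
      x * (⟦ y ⟧ *ₗ u)         ≈⟨ mod-reflexive (*-*ₗ-comm ⟦ y ⟧ x u) ⟩
      ⟦ y ⟧ *ₗ (x * u)         ≈⟨ mod-*ₗ-cong (mod-mono ⊆-+k (proj₂ (acts x) u)) ⟩
      ⟦ y ⟧ *ₗ (⟦ x ⟧ *ₗ u)    ≈⟨ mod-reflexive (*ₗ-assoc ⟦ y ⟧ ⟦ x ⟧ u) ⟨
      (⟦ y ⟧ K.* ⟦ x ⟧) *ₗ u   ≈⟨ mod-reflexive (*ₗ-congʳ (K.*-comm ⟦ y ⟧ ⟦ x ⟧)) ⟩
      (⟦ x ⟧ K.* ⟦ y ⟧) *ₗ u   ∎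
      where
      S = k∙ 1# +k x +k (x * y)
      open SetoidReasoning (mod-setoid S)

      x⟨y⟩⊆S : k∙ 1# +k y ⊆ˢ leftPreimage x S
      x⟨y⟩⊆S = +k-least
        (Line-least ⟨ resp-≈ S (sym (*-identityʳ x)) (holds (⊆-+k ∈-+k)) ⟩) ⟨ holds ∈-+k ⟩

      left-multiple : ∀ u → x * (y * u) ≈ x * (⟦ y ⟧ *ₗ u) mod S
      left-multiple u with proj₂ (acts y) u
      ... | v , v∈ , yu≈v+λu = x * v , ⟨ holds (x⟨y⟩⊆S v∈) ⟩ ,
        trans (*-congˡ yu≈v+λu) (distribˡ x v _)

    form : UnitalForm 1#
    form = record
      { ⟦_⟧     = ⟦_⟧
      ; ⟦⟧-cong = ⟦⟧-cong
      ; +-homo  = +-homo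
      -- Homogeneity is multiplicativity with the scalar `k *ₗ 1#` as first factor.
      ; *ₗ-homo = λ k x → K.trans
          (⟦⟧-cong (sym (trans (*ₗ-*-assoc k 1# x) (*ₗ-congˡ (*-identityˡ x)))))
          (K.trans (*-homo (k *ₗ 1#) x) (K.*-congʳ (scalar-homo k)))
      ; 1-homo  = K.trans (⟦⟧-cong (sym (LeftModule.*ₗ-identityˡ leftModule 1#)))
          (scalar-homo K.1#)
      }

    -- Since `x` acts as 0 modulo k1 + kx, the product is l1 + kx for some scalars. The form
    -- vanishes on `x * y` and on `x`, so it leaves `l` = 0.
    kernel-product : ∀ x y → ⟦ x ⟧ K.≈ K.0# → x * y ∈ˢ k∙ x
    kernel-product x y λx≈0
      with +k⇒mod (mod-∈ (proj₂ (acts x) y)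
             (∈ˢ-resp-≈ (sym (trans (*ₗ-congʳ λx≈0) (LeftModule.*ₗ-zeroˡ leftModule y))) 0∈ˢ))
    ... | k , u , ⟨ l , lift u≈l1 ⟩ , xy≈u+kx = ⟨ k , lift (begin
        x * y               ≈⟨ xy≈u+kx ⟩
        u + k *ₗ x          ≈⟨ +-congʳ u≈l1 ⟩
        l *ₗ 1# + k *ₗ x    ≈⟨ +-congʳ (*ₗ-congʳ l≈0) ⟩
        K.0# *ₗ 1# + k *ₗ x ≈⟨ +-congʳ (LeftModule.*ₗ-zeroˡ leftModule 1#) ⟩
        0# + k *ₗ x         ≈⟨ +-identityˡ _ ⟩
        k *ₗ x              ∎) ⟩
      where
      l≈0 : l K.≈ K.0#
      l≈0 = begin
        l                                ≈⟨ scalar-homo l ⟨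
        ⟦ l *ₗ 1# ⟧                      ≈⟨ K.+-identityʳ _ ⟨
        ⟦ l *ₗ 1# ⟧ K.+ K.0#             ≈⟨ K.+-congˡ (K.zeroʳ k) ⟨
        ⟦ l *ₗ 1# ⟧ K.+ k K.* K.0#       ≈⟨ K.+-congˡ (K.*-congˡ λx≈0) ⟨
        ⟦ l *ₗ 1# ⟧ K.+ k K.* ⟦ x ⟧      ≈⟨ K.+-congˡ (UnitalForm.*ₗ-homo form k x) ⟨
        ⟦ l *ₗ 1# ⟧ K.+ ⟦ k *ₗ x ⟧       ≈⟨ +-homo _ _ ⟨
        ⟦ l *ₗ 1# + k *ₗ x ⟧             ≈⟨ ⟦⟧-cong (trans xy≈u+kx (+-congʳ u≈l1)) ⟨
        ⟦ x * y ⟧                        ≈⟨ *-homo x y ⟩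
        ⟦ x ⟧ K.* ⟦ y ⟧                  ≈⟨ K.*-congʳ λx≈0 ⟩
        K.0# K.* ⟦ y ⟧                   ≈⟨ K.zeroˡ _ ⟩
        K.0#                             ∎
        where open SetoidReasoning K.setoid
      open SetoidReasoning setoid

    -- Packaged for use with both the algebra and its opposite.
    annihilatingForm : Σ[ φ ∈ UnitalForm 1# ]
      (∀ x y → UnitalForm.⟦_⟧ φ x K.≈ K.0# → x * y ∈ˢ k∙ x)
    annihilatingForm = form , kernel-product

-- Forms, vanishing products and the three cases

module Classification
  {c ℓ a ℓa : Level} (em : ExcludedMiddle (c ⊔ ℓ ⊔ a ⊔ ℓa))
  (K : Field c ℓ) (A : Algebra K a ℓa) where

  private module K = Field K
  open Algebra A hiding (zero)
  open LeftModule leftModule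
    using (*ₗ-congˡ; *ₗ-congʳ; *ₗ-distribˡ; *ₗ-distribʳ; *ₗ-assoc;
           *ₗ-identityˡ; *ₗ-zeroˡ; *ₗ-zeroʳ)
  open LinearAlgebra em K leftModule
  open Cases A
  open RawSum +-rawMonoid using (sum)
  open SetoidReasoning setoid
  open import Algebra.Solver.CommutativeMonoid +-commutativeMonoid
    using (solve; _⊜_; id) renaming (_⊕_ to _:+_)
  open CommSemigroupProps (CommutativeMonoid.commutativeSemigroup +-commutativeMonoid)
    using (interchange)
  private module +P = AbelianGroupProps +-abelianGroup

  scalar-* : ∀ k x → (k *ₗ 1#) * x ≈ k *ₗ x
  scalar-* k x = trans (*ₗ-*-assoc k 1# x) (*ₗ-congˡ (*-identityˡ x))

  *-scalar : ∀ k x → x * (k *ₗ 1#) ≈ k *ₗ x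
  *-scalar k x = trans (*-*ₗ-comm k x 1#) (*ₗ-congˡ (*-identityʳ x))

  module _ {p q} {X : Pred Carrier p} {Y : Pred Carrier q} where

    zero-product⁺ : (∀ {x y} → x ∈ X → y ∈ Y → x * y ≈ 0#) → (X · Y) ≐ ｛ 0# ｝
    zero-product⁺ xy≈0 =
      (λ (n , k , v , v∈ , z≈sum) → trans z≈sum (sum≈0 n k v v∈)) ,
      -- Conversely, zero lies in every span as the empty combination.
      (λ z≈0 → 0 , (λ ()) , (λ ()) , (λ ()) , z≈0)
      where
      sum≈0 : ∀ n (k : Vector K.Carrier n) (v : Vector Carrier n) →
        (∀ i → ∃[ x ] ∃[ y ] x ∈ X × y ∈ Y × v i ≈ x * y) →
        sum (λ i → k i *ₗ v i) ≈ 0#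
      sum≈0 zero    k v v∈ = refl
      sum≈0 (suc n) k v v∈ with v∈ zero
      ... | x , y , x∈X , y∈Y , v₀≈xy = begin
        head k *ₗ head v + sum (λ i → tail k i *ₗ tail v i)
          ≈⟨ +-cong (*ₗ-congˡ (trans v₀≈xy (xy≈0 x∈X y∈Y)))
                    (sum≈0 n (tail k) (tail v) (v∈ ∘ suc)) ⟩
        head k *ₗ 0# + 0#    ≈⟨ +-identityʳ _ ⟩
        head k *ₗ 0#         ≈⟨ *ₗ-zeroʳ (head k) ⟩
        0#                   ∎

    zero-product⁻ : (X · Y) ≐ ｛ 0# ｝ → ∀ {x y} → x ∈ X → y ∈ Y → x * y ≈ 0#
    zero-product⁻ (XY⊆0 , _) {x} {y} x∈X y∈Y = XY⊆0
      (1 , (λ _ → K.1#) , (λ _ → x * y) , (λ _ → x , y , x∈X , y∈Y , refl) ,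
       sym (trans (+-identityʳ _) (*ₗ-identityˡ _)))

  -- Cases (ii) and (iii) from two forms with ker L · ker R = 0

  module _ (left right : UnitalForm 1#) where
    private
      module L = UnitalForm left
      module R = UnitalForm right

    module _ (MN≈0 : ∀ {x y} → L.⟦ x ⟧ K.≈ K.0# → R.⟦ y ⟧ K.≈ K.0# → x * y ≈ 0#) where

      forms⇒caseII : (∀ {x} → L.⟦ x ⟧ K.≈ K.0# → R.⟦ x ⟧ K.≈ K.0#) → CaseII
      forms⇒caseII M⊆N = L.kernel , (decompose , unique) ,
        zero-product⁺ λ (lift x≈0) (lift y≈0) → MN≈0 x≈0 (M⊆N y≈0)
        where
        U = (k∙ 1#) ∷ L.kernel ∷ []

        decompose : ∀ x → Σ[ u ∈ Vector Carrier 2 ] (∀ i → u i ∈ members (U i)) × x ≈ sum u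
        decompose x = (L.⟦ x ⟧ *ₗ 1# ∷ L.π x ∷ []) ,
          (λ { 0F → L.⟦ x ⟧ , lift refl ; 1F → lift (L.⟦π⟧≈0 x) }) , sym (begin
            s + (x + - s + 0#)   ≈⟨ solve 3 (λ s x t → s :+ ((x :+ t) :+ id) ⊜ x :+ (s :+ t)) refl s x (- s) ⟩
            x + (s + - s)        ≈⟨ +-congˡ (-‿inverseʳ s) ⟩
            x + 0#               ≈⟨ +-identityʳ x ⟩
            x                    ∎)
          where s = L.⟦ x ⟧ *ₗ 1#

        unique : ∀ (u : Vector Carrier 2) → (∀ i → u i ∈ members (U i)) →
                 sum u ≈ 0# → ∀ i → u i ≈ 0#
        unique u u∈ sum≈0 = λ { 0F → u₀≈0 ; 1F → u₁≈0 }
          where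
          k = proj₁ (u∈ 0F)

          u₀∈ker : u 0F ∈ˢ L.kernel
          u₀∈ker = +-∈ˢ-cancelʳ (∈ˢ-resp-≈ (sym sum≈0) 0∈ˢ) (+-∈ˢ ⟨ u∈ 1F ⟩ 0∈ˢ)

          -- The component along 1 now lies in the kernel of `L`, while `L` takes the value `k` on
          -- it.
          k≈0 : k K.≈ K.0#
          k≈0 = K.trans (K.sym (L.⟦*ₗu⟧ k))
            (K.trans (L.⟦⟧-cong (sym (lower (proj₂ (u∈ 0F))))) (lower (holds u₀∈ker)))

          u₀≈0 : u 0F ≈ 0#
          u₀≈0 = trans (lower (proj₂ (u∈ 0F))) (trans (*ₗ-congʳ k≈0) (*ₗ-zeroˡ 1#))

          u₁≈0 : u 1F ≈ 0#
          u₁≈0 = begin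
            u 1F                 ≈⟨ +-identityʳ _ ⟨
            u 1F + 0#            ≈⟨ +-identityˡ _ ⟨
            0# + (u 1F + 0#)     ≈⟨ +-congʳ u₀≈0 ⟨
            u 0F + (u 1F + 0#)   ≈⟨ sum≈0 ⟩
            0#                   ∎

      module PeirceDecomposition {e} (Le≈0 : L.⟦ e ⟧ K.≈ K.0#) (Re≈1 : R.⟦ e ⟧ K.≈ K.1#) where
        private
          f = 1# + - e

          V : Subspace leftModule
          V = record
            { members   = λ x → members L.kernel x × members R.kernel x
            ; resp-≈    = λ x≈y (x∈M , x∈N) →
                resp-≈ L.kernel x≈y x∈M , resp-≈ R.kernel x≈y x∈N
            ; 0-closed  = 0-closed L.kernel , 0-closed R.kernel
            ; +-closed  = λ (x∈M , x∈N) (y∈M , y∈N) →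
                +-closed L.kernel x∈M y∈M , +-closed R.kernel x∈N y∈N
            ; *ₗ-closed = λ k (x∈M , x∈N) →
                *ₗ-closed L.kernel k x∈M , *ₗ-closed R.kernel k x∈N
            }

        Rf≈0 : R.⟦ f ⟧ K.≈ K.0#
        Rf≈0 = R.⟦⟧-difference (K.trans R.1-homo (K.sym Re≈1))

        Lf≈1 : L.⟦ f ⟧ K.≈ K.1#
        Lf≈1 = K.trans (L.+-homo 1# (- e)) (K.trans (K.+-cong L.1-homo
          (K.trans (L.-‿homo e) (K.trans (K.-‿cong Le≈0) -0≈0))) (K.+-identityʳ K.1#))
          where -0≈0 = AbelianGroupProps.ε⁻¹≈ε K.+-abelianGroup

        e+f≈1 : e + f ≈ 1#
        e+f≈1 = begin
          e + (1# + - e)   ≈⟨ solve 3 (λ e u n → e :+ (u :+ n) ⊜ u :+ (e :+ n)) refl e 1# (- e) ⟩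
          1# + (e + - e)   ≈⟨ +-congˡ (-‿inverseʳ e) ⟩
          1# + 0#          ≈⟨ +-identityʳ 1# ⟩
          1#               ∎

        ef≈0 : e * f ≈ 0#
        ef≈0 = MN≈0 Le≈0 Rf≈0

        e²≈e : e * e ≈ e
        e²≈e = begin
          e * e            ≈⟨ +-identityʳ _ ⟨
          e * e + 0#       ≈⟨ +-congˡ ef≈0 ⟨
          e * e + e * f    ≈⟨ distribˡ e e f ⟨
          e * (e + f)      ≈⟨ *-congˡ e+f≈1 ⟩
          e * 1#           ≈⟨ *-identityʳ e ⟩
          e                ∎

        f²≈f : f * f ≈ f
        f²≈f = begin
          f * f            ≈⟨ +-identityˡ _ ⟨
          0# + f * f       ≈⟨ +-congʳ ef≈0 ⟨
          e * f + f * f    ≈⟨ distribʳ f e f ⟨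
          (e + f) * f      ≈⟨ *-congʳ e+f≈1 ⟩
          1# * f           ≈⟨ *-identityˡ f ⟩
          f                ∎

        -- As L(f) = 1 and R(e) = 1, the vanishing of M·N says nothing about fe. Instead, (e + f)e =
        -- e = e² leaves nothing for it.
        fe≈0 : f * e ≈ 0#
        fe≈0 = +P.identityʳ-unique (e * e) (f * e) (begin
          e * e + f * e    ≈⟨ distribʳ e e f ⟨
          (e + f) * e      ≈⟨ *-congʳ e+f≈1 ⟩
          1# * e           ≈⟨ *-identityˡ e ⟩
          e                ≈⟨ e²≈e ⟨
          e * e            ∎)

        -- On ke + kf the form `L` is the coordinate along `f`, and `R` the one along `e`. Hence
        -- R(x)e + L(x)f is the part of `x` to split off, and the remainder lies in both kernels.
        L-combination : ∀ k l → L.⟦ k *ₗ e + l *ₗ f ⟧ K.≈ l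
        L-combination k l =
          K.trans (L.+-homo _ _) (K.trans (K.+-cong
            (K.trans (L.*ₗ-homo k e) (K.trans (K.*-congˡ Le≈0) (K.zeroʳ k)))
            (K.trans (L.*ₗ-homo l f) (K.trans (K.*-congˡ Lf≈1) (K.*-identityʳ l))))
            (K.+-identityˡ l))

        R-combination : ∀ k l → R.⟦ k *ₗ e + l *ₗ f ⟧ K.≈ k
        R-combination k l =
          K.trans (R.+-homo _ _) (K.trans (K.+-cong
            (K.trans (R.*ₗ-homo k e) (K.trans (K.*-congˡ Re≈1) (K.*-identityʳ k)))
            (K.trans (R.*ₗ-homo l f) (K.trans (K.*-congˡ Rf≈0) (K.zeroʳ l))))
            (K.+-identityʳ k))

        private
          U = (k∙ e) ∷ (k∙ f) ∷ V ∷ []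

        decompose : ∀ x → Σ[ u ∈ Vector Carrier 3 ] (∀ i → u i ∈ members (U i)) × x ≈ sum u
        decompose x = (p ∷ q ∷ x + - (p + q) ∷ []) ,
          (λ { 0F → R.⟦ x ⟧ , lift refl
             ; 1F → L.⟦ x ⟧ , lift refl
             ; 2F → lift (L.⟦⟧-difference (K.sym (L-combination _ _))) ,
                    lift (R.⟦⟧-difference (K.sym (R-combination _ _)))
             }) , sym (begin
            p + (q + (x + - (p + q) + 0#))
              ≈⟨ solve 4 (λ p q x n → p :+ (q :+ ((x :+ n) :+ id)) ⊜ x :+ ((p :+ q) :+ n))
                   refl p q x (- (p + q)) ⟩
            x + (p + q + - (p + q))   ≈⟨ +-congˡ (-‿inverseʳ _) ⟩
            x + 0#                    ≈⟨ +-identityʳ x ⟩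
            x                         ∎)
          where
          p = R.⟦ x ⟧ *ₗ e
          q = L.⟦ x ⟧ *ₗ f

        unique : ∀ (u : Vector Carrier 3) → (∀ i → u i ∈ members (U i)) →
                 sum u ≈ 0# → ∀ i → u i ≈ 0#
        unique u u∈ sum≈0 = λ { 0F → u₀≈0 ; 1F → u₁≈0 ; 2F → u₂≈0 }
          where
          k = proj₁ (u∈ 0F)
          l = proj₁ (u∈ 1F)
          u₀≈ke = lower (proj₂ (u∈ 0F))
          u₁≈lf = lower (proj₂ (u∈ 1F))

          combination+u₂≈0 : (k *ₗ e + l *ₗ f) + u 2F ≈ 0#
          combination+u₂≈0 = begin
            (k *ₗ e + l *ₗ f) + u 2F   ≈⟨ +-congʳ (+-cong u₀≈ke u₁≈lf) ⟨
            (u 0F + u 1F) + u 2F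
              ≈⟨ solve 3 (λ p q r → (p :+ q) :+ r ⊜ p :+ (q :+ (r :+ id))) refl _ _ _ ⟩
            u 0F + (u 1F + (u 2F + 0#))  ≈⟨ sum≈0 ⟩
            0#                         ∎

          -- Both forms vanish on the component in `V`, so each isolates one coefficient.
          l≈0 : l K.≈ K.0#
          l≈0 = K.trans (K.sym (L-combination k l)) (lower (holds (+-∈ˢ-cancelʳ
            {S = L.kernel} (∈ˢ-resp-≈ (sym combination+u₂≈0) 0∈ˢ) ⟨ proj₁ (u∈ 2F) ⟩)))

          k≈0 : k K.≈ K.0#
          k≈0 = K.trans (K.sym (R-combination k l)) (lower (holds (+-∈ˢ-cancelʳ
            {S = R.kernel} (∈ˢ-resp-≈ (sym combination+u₂≈0) 0∈ˢ) ⟨ proj₂ (u∈ 2F) ⟩)))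

          ke≈0 : k *ₗ e ≈ 0#
          ke≈0 = trans (*ₗ-congʳ k≈0) (*ₗ-zeroˡ e)

          lf≈0 : l *ₗ f ≈ 0#
          lf≈0 = trans (*ₗ-congʳ l≈0) (*ₗ-zeroˡ f)

          u₀≈0 = trans u₀≈ke ke≈0
          u₁≈0 = trans u₁≈lf lf≈0

          u₂≈0 : u 2F ≈ 0#
          u₂≈0 = begin
            u 2F                       ≈⟨ +-identityˡ _ ⟨
            0# + u 2F                  ≈⟨ +-congʳ (trans (+-cong ke≈0 lf≈0) (+-identityˡ 0#)) ⟨
            (k *ₗ e + l *ₗ f) + u 2F   ≈⟨ combination+u₂≈0 ⟩
            0#                         ∎

        caseIII : CaseIII
        caseIII = V , e , f , record
          { directSum = decompose , unique
          ; VV≐0  = zero-product⁺ λ (lift x≈0 , _) (_ , lift y≈0) → MN≈0 x≈0 y≈0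
          ; eV≐0  = zero-product⁺ λ x≈e (_ , lift y≈0) →
              MN≈0 (K.trans (L.⟦⟧-cong x≈e) Le≈0) y≈0
          ; Vf≐0  = zero-product⁺ λ (lift x≈0 , _) y≈f →
              MN≈0 x≈0 (K.trans (R.⟦⟧-cong y≈f) Rf≈0)
          ; e²≈e  = e²≈e
          ; f²≈f  = f²≈f
          ; ef≈0  = ef≈0
          ; fe≈0  = fe≈0
          ; e+f≈1 = e+f≈1
          }

      forms⇒caseII⊎caseIII : CaseII ⊎ CaseIII
      forms⇒caseII⊎caseIII
        with em {∃[ x ] Lift (c ⊔ ℓa) (L.⟦ x ⟧ K.≈ K.0# × ¬ R.⟦ x ⟧ K.≈ K.0#)}
      ... | no ∄x = inj₁ (forms⇒caseII λ {x} Lx≈0 →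
        decidable-stable (isZero? R.⟦ x ⟧) λ Rx≉0 → ∄x (x , lift (Lx≈0 , Rx≉0)))
      -- Scaling `x` by the inverse of R(x) stays in M and makes the value of `R` equal to 1.
      ... | yes (x , lift (Lx≈0 , Rx≉0)) with K.invertible R.⟦ x ⟧ Rx≉0
      ...   | k , k*Rx≈1 , _ = inj₂ (PeirceDecomposition.caseIII {e = k *ₗ x}
        (K.trans (L.*ₗ-homo k x) (K.trans (K.*-congˡ Lx≈0) (K.zeroʳ k)))
        (K.trans (R.*ₗ-homo k x) k*Rx≈1))

  -- Case (i) as a failure of xy to lie in k1 + kx + ky

  spanned : ∀ {T : Subspace leftModule} x y → T ⊆ˢ k∙ 1# +k x +k y → SpannedOver 3 0ˢ T
  spanned x y T⊆ = 1# , x , y , +k-mono (+k-mono (Line-least ∈-+k)) ∘ T⊆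

  dim≥4⇒∃∉ : Dim≥ leftModule 4 → ∀ x y → ∃[ z ] z ∉ˢ k∙ 1# +k x +k y
  dim≥4⇒∃∉ d x y = dim≥⇒∃∉ 3 d _ (spanned x y λ z∈ → z∈)

  -- Bridges the opaque `_+k_` and the sum by which case (i) is stated.
  caseI-subspace : ∀ x y → k∙ 1# +k x +k y +k (x * y) ≡
    (k∙ 1#) +ˢ (k∙ x) +ˢ (k∙ y) +ˢ (k∙ (x * y))
  caseI-subspace x y = ≡.trans +k-unfold (≡.cong (_+ˢ (k∙ (x * y)))
    (≡.trans +k-unfold (≡.cong (_+ˢ (k∙ y)) +k-unfold)))

  *-dependent⇒¬caseI : (∀ x y → x * y ∈ˢ k∙ 1# +k x +k y) → ¬ CaseI
  *-dependent⇒¬caseI xy∈ (x , y , dim≥4) = dim≥-asModule T 3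
    (≡.subst (λ T → Dim≥ (asModule T) 4) (≡.sym (caseI-subspace x y)) dim≥4)
    (spanned x y (+k-least (λ z∈ → z∈) (xy∈ x y)))
    where T = k∙ 1# +k x +k y +k (x * y)

  -- Independence is built up one vector at a time, each avoiding the span of its predecessors. For
  -- the first one, 1 = 0 would give `x` = 0, which lies in k1.
  independent⇒caseI : ∀ {x y} → x ∉ˢ k∙ 1# → y ∉ˢ k∙ 1# +k x →
                      x * y ∉ˢ k∙ 1# +k x +k y → CaseI
  independent⇒caseI {x} {y} x∉ y∉ xy∉ = x , y ,
    ≡.subst (λ T → Dim≥ (asModule T) 4) (caseI-subspace x y)
      (v , independent-asModule⁺ T v
        (independent-∷ 0ˢ w 1∉
          (independent-∷ (0ˢ +k 1#) (tail w) (x∉ ∘ 0+1⊆)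
            (independent-∷ (0ˢ +k 1# +k x) (tail (tail w)) (y∉ ∘ +k-mono 0+1⊆)
              (independent-∷ (0ˢ +k 1# +k x +k y) (tail (tail (tail w))) (xy∉ ∘ +k-mono (+k-mono 0+1⊆))
                (independent-[] _ (tail (tail (tail (tail w))))))))))
    where
    T = k∙ 1# +k x +k y +k (x * y)

    v : Vector (∃[ z ] z ∈ members T) 4
    v = (1# , holds (⊆-+k (⊆-+k (⊆-+k ∈-Line))))
      ∷ (x , holds (⊆-+k (⊆-+k ∈-+k)))
      ∷ (y , holds (⊆-+k ∈-+k))
      ∷ (x * y , holds ∈-+k)
      ∷ []
    w = proj₁ ∘ v

    0+1⊆ : 0ˢ +k 1# ⊆ˢ k∙ 1#
    0+1⊆ = +k-least (λ z∈0 → ∈ˢ-resp-≈ (sym (lower (holds z∈0))) 0∈ˢ) ∈-Line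

    1∉ : 1# ∉ˢ 0ˢ
    1∉ ⟨ lift 1≈0 ⟩ = x∉ (∈ˢ-resp-≈ (begin
      0#          ≈⟨ zeroˡ x ⟨
      0# * x      ≈⟨ *-congʳ 1≈0 ⟨
      1# * x      ≈⟨ *-identityˡ x ⟩
      x           ∎) 0∈ˢ)

  -- This is (x − k)(y − l) = 0 solved for xy, with k q in place of k y − k l.
  factors⇒*-dependent : ∀ {x y p q} k l → x ≈ k *ₗ 1# + p → y ≈ l *ₗ 1# + q →
    p * q ≈ 0# → x * y ≈ l *ₗ x + k *ₗ q
  factors⇒*-dependent {x} {y} {p} {q} k l x≈k+p y≈l+q pq≈0 = begin
    x * y                          ≈⟨ *-congˡ y≈l+q ⟩
    x * (l *ₗ 1# + q)              ≈⟨ distribˡ x _ q ⟩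
    x * (l *ₗ 1#) + x * q          ≈⟨ +-cong (*-scalar l x) (*-congʳ x≈k+p) ⟩
    l *ₗ x + (k *ₗ 1# + p) * q     ≈⟨ +-congˡ (distribʳ q _ p) ⟩
    l *ₗ x + ((k *ₗ 1#) * q + p * q)  ≈⟨ +-congˡ (+-cong (scalar-* k q) pq≈0) ⟩
    l *ₗ x + (k *ₗ q + 0#)         ≈⟨ +-congˡ (+-identityʳ _) ⟩
    l *ₗ x + k *ₗ q                ∎

  -- Here `q` is y - l1, so xy = lx + kq stays in k1 + kx + ky, and three vectors span the sum in
  -- case (i).
  factors⇒¬caseI :
    (∀ x y → ∃[ k ] ∃[ l ] ∃[ p ] ∃[ q ]
      x ≈ k *ₗ 1# + p × y ≈ l *ₗ 1# + q × p * q ≈ 0#) → ¬ CaseI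
  factors⇒¬caseI factors = *-dependent⇒¬caseI xy∈
    where
    xy∈ : ∀ x y → x * y ∈ˢ k∙ 1# +k x +k y
    xy∈ x y with factors x y
    ... | k , l , p , q , x≈k+p , y≈l+q , pq≈0 =
      ∈ˢ-resp-≈ (sym (factors⇒*-dependent k l x≈k+p y≈l+q pq≈0))
        (+-∈ˢ (*ₗ-∈ˢ l (⊆-+k ∈-+k)) (*ₗ-∈ˢ k q∈))
      where
      q∈ : q ∈ˢ k∙ 1# +k x +k y
      q∈ = +-∈ˢ-cancelʳ (∈ˢ-resp-≈ (trans y≈l+q (+-comm _ q)) ∈-+k)
             (⊆-+k (⊆-+k (*ₗ-∈ˢ l ∈-Line)))

  -- Case (ii) excludes (i) and makes the algebra commutative

  module CaseIIProperties (caseII : CaseII) where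
    private
      V      = proj₁ caseII
      decomp = proj₁ (proj₁ (proj₂ caseII))
      VV≐0   = proj₂ (proj₂ caseII)

    decomposeII : ∀ x → ∃[ k ] ∃[ v ] v ∈ members V × x ≈ k *ₗ 1# + v
    decomposeII x with decomp x
    ... | u , u∈ , x≈sum = proj₁ (u∈ 0F) , u 1F , u∈ 1F ,
      trans x≈sum (+-cong (lower (proj₂ (u∈ 0F))) (+-identityʳ (u 1F)))

    caseII⇒¬caseI : ¬ CaseI
    caseII⇒¬caseI = factors⇒¬caseI factors
      where
      factors : ∀ x y → ∃[ k ] ∃[ l ] ∃[ p ] ∃[ q ]
        x ≈ k *ₗ 1# + p × y ≈ l *ₗ 1# + q × p * q ≈ 0#
      factors x y with decomposeII x | decomposeII y
      ... | k , p , p∈V , x≈ | l , q , q∈V , y≈ =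
        k , l , p , q , x≈ , y≈ , zero-product⁻ VV≐0 p∈V q∈V

    -- With pq = qp = 0, both products expand to kl1 + kq + lp. Commutativity is what separates (ii)
    -- from (iii).
    caseII⇒*-comm : ∀ x y → x * y ≈ y * x
    caseII⇒*-comm x y with decomposeII x | decomposeII y
    ... | k , p , p∈V , x≈k+p | l , q , q∈V , y≈l+q = begin
      x * y
        ≈⟨ factors⇒*-dependent k l x≈k+p y≈l+q (zero-product⁻ VV≐0 p∈V q∈V) ⟩
      l *ₗ x + k *ₗ q                          ≈⟨ +-congʳ (expand l k x≈k+p) ⟩
      ((l K.* k) *ₗ 1# + l *ₗ p) + k *ₗ q
        ≈⟨ solve 3 (λ s t u → (s :+ t) :+ u ⊜ (s :+ u) :+ t) refl _ _ _ ⟩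
      ((l K.* k) *ₗ 1# + k *ₗ q) + l *ₗ p      ≈⟨ +-congʳ (+-congʳ (*ₗ-congʳ (K.*-comm l k))) ⟩
      ((k K.* l) *ₗ 1# + k *ₗ q) + l *ₗ p      ≈⟨ +-congʳ (expand k l y≈l+q) ⟨
      k *ₗ y + l *ₗ p
        ≈⟨ factors⇒*-dependent l k y≈l+q x≈k+p (zero-product⁻ VV≐0 q∈V p∈V) ⟨
      y * x                                    ∎
      where
      expand : ∀ l k {x p} → x ≈ k *ₗ 1# + p → l *ₗ x ≈ (l K.* k) *ₗ 1# + l *ₗ p
      expand l k x≈k+p = trans (*ₗ-congˡ x≈k+p)
        (trans (*ₗ-distribˡ l _ _) (+-congʳ (sym (*ₗ-assoc l k 1#))))

  -- Multiplication in case (iii), and the exclusion of (i) and (ii)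

  module PeirceProperties {V e f} (P : IsPeirceTriple V e f) where
    open IsPeirceTriple P

    decomposeIII : ∀ x → ∃[ k ] ∃[ l ] ∃[ v ]
      v ∈ members V × x ≈ k *ₗ e + (l *ₗ f + v)
    decomposeIII x with proj₁ directSum x
    ... | u , u∈ , x≈sum = proj₁ (u∈ 0F) , proj₁ (u∈ 1F) , u 2F , u∈ 2F ,
      trans x≈sum (+-cong (lower (proj₂ (u∈ 0F)))
        (+-cong (lower (proj₂ (u∈ 1F))) (+-identityʳ (u 2F))))

    module _ {v} (v∈V : v ∈ members V) where

      ev≈0 : e * v ≈ 0#
      ev≈0 = zero-product⁻ eV≐0 refl v∈V

      vf≈0 : v * f ≈ 0#
      vf≈0 = zero-product⁻ Vf≐0 v∈V refl

      -- In Peirce terms `V` is fAe: as e + f = 1, what `e` kills from the left is fixed by `f`, and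
      -- likewise on the right with the roles exchanged.
      fv≈v : f * v ≈ v
      fv≈v = begin
        f * v            ≈⟨ +-identityˡ _ ⟨
        0# + f * v       ≈⟨ +-congʳ ev≈0 ⟨
        e * v + f * v    ≈⟨ distribʳ v e f ⟨
        (e + f) * v      ≈⟨ *-congʳ e+f≈1 ⟩
        1# * v           ≈⟨ *-identityˡ v ⟩
        v                ∎

      ve≈v : v * e ≈ v
      ve≈v = begin
        v * e            ≈⟨ +-identityʳ _ ⟨
        v * e + 0#       ≈⟨ +-congˡ vf≈0 ⟨
        v * e + v * f    ≈⟨ distribˡ v e f ⟨
        v * (e + f)      ≈⟨ *-congˡ e+f≈1 ⟩
        v * 1#           ≈⟨ *-identityʳ v ⟩
        v                ∎

    -- All four products ef, ew, vf and vw vanish.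
    [ke+v][lf+w]≈0 : ∀ {v w} k l → v ∈ members V → w ∈ members V →
                     (k *ₗ e + v) * (l *ₗ f + w) ≈ 0#
    [ke+v][lf+w]≈0 {v} {w} k l v∈V w∈V = begin
      (k *ₗ e + v) * (l *ₗ f + w)                    ≈⟨ distribʳ _ _ v ⟩
      (k *ₗ e) * (l *ₗ f + w) + v * (l *ₗ f + w)
        ≈⟨ +-cong (trans (*ₗ-*-assoc k e _) (*ₗ-congˡ (right e ef≈0 (ev≈0 w∈V))))
                  (right v (vf≈0 v∈V) (zero-product⁻ VV≐0 v∈V w∈V)) ⟩
      k *ₗ 0# + 0#                                   ≈⟨ +-identityʳ _ ⟩
      k *ₗ 0#                                        ≈⟨ *ₗ-zeroʳ k ⟩
      0#                                             ∎
      where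
      right : ∀ x → x * f ≈ 0# → x * w ≈ 0# → x * (l *ₗ f + w) ≈ 0#
      right x xf≈0 xw≈0 = begin
        x * (l *ₗ f + w)         ≈⟨ distribˡ x _ w ⟩
        x * (l *ₗ f) + x * w     ≈⟨ +-cong (trans (*-*ₗ-comm l x f) (*ₗ-congˡ xf≈0)) xw≈0 ⟩
        l *ₗ 0# + 0#             ≈⟨ +-identityʳ _ ⟩
        l *ₗ 0#                  ≈⟨ *ₗ-zeroʳ l ⟩
        0#                       ∎

    shift : ∀ k l x → k *ₗ x ≈ l *ₗ x + (k K.+ K.- l) *ₗ x
    shift k l x = sym (begin
      l *ₗ x + (k K.+ K.- l) *ₗ x            ≈⟨ +-congˡ (*ₗ-distribʳ x k (K.- l)) ⟩
      l *ₗ x + (k *ₗ x + (K.- l) *ₗ x)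
        ≈⟨ solve 3 (λ s t u → s :+ (t :+ u) ⊜ t :+ (s :+ u)) refl _ _ _ ⟩
      k *ₗ x + (l *ₗ x + (K.- l) *ₗ x)       ≈⟨ +-congˡ (*ₗ-distribʳ x l (K.- l)) ⟨
      k *ₗ x + (l K.+ K.- l) *ₗ x            ≈⟨ +-congˡ (*ₗ-congʳ (K.-‿inverseʳ l)) ⟩
      k *ₗ x + K.0# *ₗ x                     ≈⟨ +-congˡ (*ₗ-zeroˡ x) ⟩
      k *ₗ x + 0#                            ≈⟨ +-identityʳ _ ⟩
      k *ₗ x                                 ∎)

    k1≈ke+kf : ∀ k → k *ₗ 1# ≈ k *ₗ e + k *ₗ f
    k1≈ke+kf k = trans (*ₗ-congˡ (sym e+f≈1)) (*ₗ-distribˡ k e f)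

    -- Since 1 = e + f, taking out l1 cancels the component along `f`.
    e-shift : ∀ k l v → k *ₗ e + (l *ₗ f + v) ≈ l *ₗ 1# + ((k K.+ K.- l) *ₗ e + v)
    e-shift k l v = begin
      k *ₗ e + (l *ₗ f + v)                          ≈⟨ +-congʳ (shift k l e) ⟩
      (l *ₗ e + (k K.+ K.- l) *ₗ e) + (l *ₗ f + v)   ≈⟨ interchange _ _ _ _ ⟩
      (l *ₗ e + l *ₗ f) + ((k K.+ K.- l) *ₗ e + v)   ≈⟨ +-congʳ (k1≈ke+kf l) ⟨
      l *ₗ 1# + ((k K.+ K.- l) *ₗ e + v)             ∎

    f-shift : ∀ k l v → k *ₗ e + (l *ₗ f + v) ≈ k *ₗ 1# + ((l K.+ K.- k) *ₗ f + v)
    f-shift k l v = begin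
      k *ₗ e + (l *ₗ f + v)                          ≈⟨ +-congˡ (+-congʳ (shift l k f)) ⟩
      k *ₗ e + ((k *ₗ f + (l K.+ K.- k) *ₗ f) + v)   ≈⟨ +-congˡ (+-assoc _ _ _) ⟩
      k *ₗ e + (k *ₗ f + ((l K.+ K.- k) *ₗ f + v))   ≈⟨ +-assoc _ _ _ ⟨
      (k *ₗ e + k *ₗ f) + ((l K.+ K.- k) *ₗ f + v)   ≈⟨ +-congʳ (k1≈ke+kf k) ⟨
      k *ₗ 1# + ((l K.+ K.- k) *ₗ f + v)             ∎

    -- For x = k e + l f + v and y = k′ e + l′ f + w the factors are
    -- x − l ∈ ke + V and y − k′ ∈ kf + V.
    caseIII⇒¬caseI : ¬ CaseI
    caseIII⇒¬caseI = factors⇒¬caseI factors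
      where
      factors : ∀ x y → ∃[ k ] ∃[ l ] ∃[ p ] ∃[ q ]
        x ≈ k *ₗ 1# + p × y ≈ l *ₗ 1# + q × p * q ≈ 0#
      factors x y with decomposeIII x | decomposeIII y
      ... | k , l , v , v∈V , x≈ | k′ , l′ , w , w∈V , y≈ =
        l , k′ , _ , _ , trans x≈ (e-shift k l v) , trans y≈ (f-shift k′ l′ w) ,
        [ke+v][lf+w]≈0 _ _ v∈V w∈V

    V≈0⇒spanned : (∀ {v} → v ∈ members V → v ≈ 0#) → ∀ x → x ∈ˢ k∙ 1# +k e +k f
    V≈0⇒spanned V≈0 x with decomposeIII x
    ... | k , l , v , v∈V , x≈ = ∈ˢ-resp-≈ (sym x≈)
      (+-∈ˢ (*ₗ-∈ˢ k (⊆-+k ∈-+k))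
        (+-∈ˢ (*ₗ-∈ˢ l ∈-+k) (∈ˢ-resp-≈ (sym (V≈0 v∈V)) 0∈ˢ)))

    -- With `V` = 0 the algebra would be ke + kf, which leaves no vector outside k1 + ke + kf.
    V≉0 : Dim≥ leftModule 4 → ¬ (∀ {v} → v ∈ members V → v ≈ 0#)
    V≉0 d V≈0 = proj₂ (dim≥4⇒∃∉ d e f) (V≈0⇒spanned V≈0 _)

    -- `e` fixes `V` from the right and kills it from the left. Together with `V≉0` this rules out a
    -- commutative algebra in case (iii).
    *-comm⇒V≈0 : (∀ x y → x * y ≈ y * x) → ∀ {v} → v ∈ members V → v ≈ 0#
    *-comm⇒V≈0 comm {v} v∈V = begin
      v        ≈⟨ ve≈v v∈V ⟨
      v * e    ≈⟨ comm v e ⟩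
      e * v    ≈⟨ ev≈0 v∈V ⟩
      0#       ∎

  -- The product of the two kernels is zero

  module _ (left right : UnitalForm 1#)
    (∃∉ : ∀ x y → ∃[ z ] z ∉ˢ k∙ 1# +k x +k y) where
    private
      module L = UnitalForm left
      module R = UnitalForm right

    module _ (xA⊆kx : ∀ x y → L.⟦ x ⟧ K.≈ K.0# → x * y ∈ˢ k∙ x)
             (Ay⊆ky : ∀ x y → R.⟦ y ⟧ K.≈ K.0# → x * y ∈ˢ k∙ y) where

      -- The product lies in both kx and ky, and these lines meet only in 0 when `y` is outside kx.
      MN≈0-∉ : ∀ {x y} → L.⟦ x ⟧ K.≈ K.0# → R.⟦ y ⟧ K.≈ K.0# → y ∉ˢ k∙ x → x * y ≈ 0#
      MN≈0-∉ {x} {y} Lx≈0 Ry≈0 y∉kx with Ay⊆ky x y Ry≈0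
      ... | ⟨ k , lift xy≈ky ⟩ = trans xy≈ky (trans (*ₗ-congʳ k≈0) (*ₗ-zeroˡ y))
        where k≈0 = coefficient-zero y∉kx (∈ˢ-resp-≈ xy≈ky (xA⊆kx x y Lx≈0))

      -- If y ∈ kx, then some z in the kernel of R has both z and y + z
      -- outside kx.
      MN≈0 : ∀ {x y} → L.⟦ x ⟧ K.≈ K.0# → R.⟦ y ⟧ K.≈ K.0# → x * y ≈ 0#
      MN≈0 {x} {y} Lx≈0 Ry≈0 with ∈-dec (k∙ x) y
      ... | no  y∉kx = MN≈0-∉ Lx≈0 Ry≈0 y∉kx
      ... | yes y∈kx = begin
        x * y             ≈⟨ +-identityʳ _ ⟨
        x * y + 0#        ≈⟨ +-congˡ (MN≈0-∉ Lx≈0 (R.⟦π⟧≈0 w) z∉kx) ⟨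
        x * y + x * z     ≈⟨ distribˡ x y z ⟨
        x * (y + z)       ≈⟨ MN≈0-∉ Lx≈0 R[y+z]≈0 y+z∉kx ⟩
        0#                ∎
        where
        -- `w` avoids k1 + kx, and `z` differs from it by a multiple of 1, so `z` avoids kx.
        w = proj₁ (∃∉ x x)
        z = R.π w

        z∉kx : z ∉ˢ k∙ x
        z∉kx z∈kx = proj₂ (∃∉ x x) (+-∈ˢ-cancelʳ
          (Line-least (⊆-+k ∈-+k) z∈kx)
          (-ᴹ-∈ˢ (*ₗ-∈ˢ R.⟦ w ⟧ (⊆-+k (⊆-+k ∈-Line)))))

        y+z∉kx : y + z ∉ˢ k∙ x
        y+z∉kx y+z∈kx = z∉kx (+-∈ˢ-cancelʳ (∈ˢ-resp-≈ (+-comm y z) y+z∈kx) y∈kx)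

        R[y+z]≈0 : R.⟦ y + z ⟧ K.≈ K.0#
        R[y+z]≈0 = K.trans (R.+-homo y z)
          (K.trans (K.+-cong Ry≈0 (R.⟦π⟧≈0 w)) (K.+-identityˡ K.0#))

-- Exactly one of the three cases holds

module Trichotomy
  {c ℓ a ℓa : Level} (em : ExcludedMiddle (c ⊔ ℓ ⊔ a ⊔ ℓa))
  (K : Field c ℓ) (A : Algebra K a ℓa)
  (dim≥4 : Dim≥ (Algebra.leftModule A) 4) where

  open Algebra A hiding (zero)
  open LinearAlgebra em K leftModule
  open Classification em K A
  open Cases A

  -- Turns right multiplication into left multiplication over the same vector space, so `R` arises
  -- as the form of the opposite algebra.
  opposite : Algebra K a ℓa
  opposite = record
    { ring         = Op.ring ring
    ; _*ₗ_         = _*ₗ_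
    ; isLeftModule = isLeftModule
    ; *ₗ-*-assoc   = λ k x y → *-*ₗ-comm k y x
    ; *-*ₗ-comm    = λ k x y → *ₗ-*-assoc k y x
    }

  module _ (¬caseI : ¬ CaseI) where

    ∃∉ = dim≥4⇒∃∉ dim≥4

    xy∈ : ∀ {x y} → x ∉ˢ k∙ 1# → y ∉ˢ k∙ 1# +k x → x * y ∈ˢ k∙ 1# +k x +k y
    xy∈ x∉ y∉ = decidable-stable (∈-dec _ _) (¬caseI ∘ independent⇒caseI x∉ y∉)

    -- By `exchange` the independence of 1, `x`, `y` is symmetric in `x` and `y`, so `xy∈` applies
    -- with the two swapped. This is the hypothesis of the eigenvalue argument for the opposite
    -- algebra.
    yx∈ : ∀ {x y} → x ∉ˢ k∙ 1# → y ∉ˢ k∙ 1# +k x → y * x ∈ˢ k∙ 1# +k x +k y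
    yx∈ x∉ y∉ = +k-swap (xy∈ (y∉ ∘ ⊆-+k) (λ x∈ → y∉ (exchange x∈ x∉)))

    caseII⊎caseIII : CaseII ⊎ CaseIII
    caseII⊎caseIII = forms⇒caseII⊎caseIII (proj₁ left) (proj₁ right)
      (MN≈0 (proj₁ left) (proj₁ right) ∃∉ (proj₂ left) (λ x y → proj₂ right y x))
      where
      left  = EigenvalueForm.annihilatingForm em K A ∃∉ xy∈
      right = EigenvalueForm.annihilatingForm em K opposite ∃∉ yx∈

  exactlyOne : ExactlyOneOf₃ CaseI CaseII CaseIII
  exactlyOne = exhaustive ,
    (λ (i , ii) → CaseIIProperties.caseII⇒¬caseI ii i) ,
    (λ (i , _ , _ , _ , P) → PeirceProperties.caseIII⇒¬caseI P i) ,
    (λ (ii , _ , _ , _ , P) → PeirceProperties.V≉0 P dim≥4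
      (PeirceProperties.*-comm⇒V≈0 P (CaseIIProperties.caseII⇒*-comm ii)))
    where
    exhaustive : CaseI ⊎ CaseII ⊎ CaseIII
    exhaustive with em {CaseI}
    ... | yes caseI  = inj₁ caseI
    ... | no  ¬caseI = inj₂ (caseII⊎caseIII ¬caseI)

-- Isomorphisms from split monomorphisms

module _ {c ℓ a ℓa b ℓb : Level} {K : Field c ℓ}
         (A : Algebra K a ℓa) (B : Algebra K b ℓb) where

  private
    module A = Algebra A
    module B = Algebra B
  open RingMorphisms B.rawRing A.rawRing using (IsRingMonomorphism)

  -- Every law for `h`, including that it respects equality, becomes after applying the injective
  -- `g` a law that holds for `g`; `reflect` carries it back.
  splitMonomorphism⇒≅ : ∀ {g} → IsRingMonomorphism g →
    (∀ k x → g (k B.*ₗ x) A.≈ (k A.*ₗ g x)) →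
    ∀ h → (∀ x → g (h x) A.≈ x) → A ≅ B
  splitMonomorphism⇒≅ {g} mono g-*ₗ-homo h gh≈id = record
    { ⟦_⟧ = h
    ; isRingIsomorphism = record
      { isRingMonomorphism = record
        { isRingHomomorphism = record
          { isSemiringHomomorphism = record
            { isNearSemiringHomomorphism = record
              { +-isMonoidHomomorphism = record
                { isMagmaHomomorphism = record
                  { isRelHomomorphism = record
                    { cong = λ x≈y → reflect x≈y (gh≈id _) }
                  ; homo = λ x y → reflect A.refl (A.trans (g.+-homo (h x) (h y))
                      (A.+-cong (gh≈id x) (gh≈id y)))
                  }
                ; ε-homo = reflect A.refl g.0#-homo
                }
              ; *-homo = λ x y → reflect A.refl (A.trans (g.*-homo (h x) (h y))
                  (A.*-cong (gh≈id x) (gh≈id y)))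
              }
            ; 1#-homo = reflect A.refl g.1#-homo
            }
          ; -‿homo = λ x → reflect A.refl
              (A.trans (g.-‿homo (h x)) (A.-‿cong (gh≈id x)))
          }
        ; injective = λ {x} {y} hx≈hy →
            A.trans (A.sym (gh≈id x)) (A.trans (g.⟦⟧-cong hx≈hy) (gh≈id y))
        }
      ; surjective = λ y → g y , λ z≈gy → reflect z≈gy A.refl
      }
    ; *ₗ-homo = λ k x → reflect A.refl
        (A.trans (g-*ₗ-homo k (h x)) (*ₗ-congˡ (gh≈id x)))
    }
    where
    module g = IsRingMonomorphism mono
    open LeftModule A.leftModule using (*ₗ-congˡ)

    reflect : ∀ {x y z} → x A.≈ y → g z A.≈ y → h x B.≈ z
    reflect x≈y gz≈y =
      g.injective (A.trans (gh≈id _) (A.trans x≈y (A.sym gz≈y)))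

-- Case (iii) as a triangular matrix algebra

module TriangularForm
  {c ℓ a ℓa : Level} (em : ExcludedMiddle (c ⊔ ℓ ⊔ a ⊔ ℓa))
  (K : Field c ℓ) (A : Algebra K a ℓa)
  (dim≥4 : Dim≥ (Algebra.leftModule A) 4) where

  private module K = Field K
  open Algebra A hiding (zero)
  open LeftModule leftModule
    using (*ₗ-congˡ; *ₗ-congʳ; *ₗ-distribˡ; *ₗ-distribʳ; *ₗ-assoc;
           *ₗ-identityˡ; *ₗ-zeroˡ; *ₗ-zeroʳ)
  open LinearAlgebra em K leftModule
  open Classification em K A
  open Cases A
  open SetoidReasoning setoid
  open CommSemigroupProps (CommutativeMonoid.commutativeSemigroup +-commutativeMonoid)
    using (interchange)

  module _ {V e f} (P : IsPeirceTriple V e f) where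
    open IsPeirceTriple P
    open PeirceProperties P

    private
      B = Triangular K (asModule V)
      module B = Algebra B
      open RingMorphisms B.rawRing rawRing

    combine : K.Carrier → K.Carrier → Carrier → Carrier
    combine k l v = k *ₗ e + (l *ₗ f + v)

    combine-cong : ∀ {k k′ l l′ v v′} → k K.≈ k′ → l K.≈ l′ → v ≈ v′ →
                   combine k l v ≈ combine k′ l′ v′
    combine-cong k≈ l≈ v≈ = +-cong (*ₗ-congʳ k≈) (+-cong (*ₗ-congʳ l≈) v≈)

    combine-+ : ∀ k k′ l l′ v v′ →
      combine (k K.+ k′) (l K.+ l′) (v + v′) ≈ combine k l v + combine k′ l′ v′
    combine-+ k k′ l l′ v v′ = begin
      (k K.+ k′) *ₗ e + ((l K.+ l′) *ₗ f + (v + v′))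
        ≈⟨ +-cong (*ₗ-distribʳ e k k′) (+-congʳ (*ₗ-distribʳ f l l′)) ⟩
      (k *ₗ e + k′ *ₗ e) + ((l *ₗ f + l′ *ₗ f) + (v + v′))
        ≈⟨ +-congˡ (interchange _ _ _ _) ⟩
      (k *ₗ e + k′ *ₗ e) + ((l *ₗ f + v) + (l′ *ₗ f + v′))
        ≈⟨ interchange _ _ _ _ ⟩
      combine k l v + combine k′ l′ v′  ∎

    combine-*ₗ : ∀ m k l v → combine (m K.* k) (m K.* l) (m *ₗ v) ≈ m *ₗ combine k l v
    combine-*ₗ m k l v = sym (begin
      m *ₗ (k *ₗ e + (l *ₗ f + v))                ≈⟨ *ₗ-distribˡ m _ _ ⟩
      m *ₗ (k *ₗ e) + m *ₗ (l *ₗ f + v)           ≈⟨ +-congˡ (*ₗ-distribˡ m _ _) ⟩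
      m *ₗ (k *ₗ e) + (m *ₗ (l *ₗ f) + m *ₗ v)
        ≈⟨ +-cong (*ₗ-assoc m k e) (+-congʳ (*ₗ-assoc m l f)) ⟨
      combine (m K.* k) (m K.* l) (m *ₗ v)        ∎)

    *-combine : ∀ x k l v → x * combine k l v ≈ k *ₗ (x * e) + (l *ₗ (x * f) + x * v)
    *-combine x k l v = begin
      x * (k *ₗ e + (l *ₗ f + v))                 ≈⟨ distribˡ x _ _ ⟩
      x * (k *ₗ e) + x * (l *ₗ f + v)             ≈⟨ +-congˡ (distribˡ x _ _) ⟩
      x * (k *ₗ e) + (x * (l *ₗ f) + x * v)
        ≈⟨ +-cong (*-*ₗ-comm k x e) (+-congʳ (*-*ₗ-comm l x f)) ⟩
      k *ₗ (x * e) + (l *ₗ (x * f) + x * v)       ∎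

    combine-*ʳ : ∀ k l v y → combine k l v * y ≈ k *ₗ (e * y) + (l *ₗ (f * y) + v * y)
    combine-*ʳ k l v y = begin
      (k *ₗ e + (l *ₗ f + v)) * y                 ≈⟨ distribʳ y _ _ ⟩
      (k *ₗ e) * y + (l *ₗ f + v) * y             ≈⟨ +-congˡ (distribʳ y _ _) ⟩
      (k *ₗ e) * y + ((l *ₗ f) * y + v * y)
        ≈⟨ +-cong (*ₗ-*-assoc k e y) (+-congʳ (*ₗ-*-assoc l f y)) ⟩
      k *ₗ (e * y) + (l *ₗ (f * y) + v * y)       ∎

    -- On `V`, `f` is a left identity and `e` a right identity, so the mixed products leave lv′ from
    -- fV and k′v from Ve; the other products with `V` vanish.
    combine-* : ∀ k k′ l l′ {v v′} → v ∈ members V → v′ ∈ members V →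
      combine (k K.* k′) (l K.* l′) (l *ₗ v′ + k′ *ₗ v) ≈ combine k l v * combine k′ l′ v′
    combine-* k k′ l l′ {v} {v′} v∈V v′∈V = sym (begin
      combine k l v * y                                    ≈⟨ combine-*ʳ k l v y ⟩
      k *ₗ (e * y) + (l *ₗ (f * y) + v * y)
        ≈⟨ +-cong (*ₗ-congˡ e*y) (+-cong (*ₗ-congˡ f*y) v*y) ⟩
      k *ₗ (k′ *ₗ e) + (l *ₗ (l′ *ₗ f + v′) + k′ *ₗ v)
        ≈⟨ +-cong (sym (*ₗ-assoc k k′ e)) (+-congʳ (*ₗ-distribˡ l _ _)) ⟩
      (k K.* k′) *ₗ e + ((l *ₗ (l′ *ₗ f) + l *ₗ v′) + k′ *ₗ v)
        ≈⟨ +-congˡ (trans (+-assoc _ _ _) (+-congʳ (sym (*ₗ-assoc l l′ f)))) ⟩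
      combine (k K.* k′) (l K.* l′) (l *ₗ v′ + k′ *ₗ v)    ∎)
      where
      y = combine k′ l′ v′

      e*y : e * y ≈ k′ *ₗ e
      e*y = begin
        e * y                                        ≈⟨ *-combine e k′ l′ v′ ⟩
        k′ *ₗ (e * e) + (l′ *ₗ (e * f) + e * v′)
          ≈⟨ +-cong (*ₗ-congˡ e²≈e) (+-cong (*ₗ-congˡ ef≈0) (ev≈0 v′∈V)) ⟩
        k′ *ₗ e + (l′ *ₗ 0# + 0#)                    ≈⟨ +-congˡ (+-identityʳ _) ⟩
        k′ *ₗ e + l′ *ₗ 0#                           ≈⟨ +-congˡ (*ₗ-zeroʳ l′) ⟩
        k′ *ₗ e + 0#                                 ≈⟨ +-identityʳ _ ⟩
        k′ *ₗ e                                      ∎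

      f*y : f * y ≈ l′ *ₗ f + v′
      f*y = begin
        f * y                                        ≈⟨ *-combine f k′ l′ v′ ⟩
        k′ *ₗ (f * e) + (l′ *ₗ (f * f) + f * v′)
          ≈⟨ +-cong (*ₗ-congˡ fe≈0) (+-cong (*ₗ-congˡ f²≈f) (fv≈v v′∈V)) ⟩
        k′ *ₗ 0# + (l′ *ₗ f + v′)                    ≈⟨ +-congʳ (*ₗ-zeroʳ k′) ⟩
        0# + (l′ *ₗ f + v′)                          ≈⟨ +-identityˡ _ ⟩
        l′ *ₗ f + v′                                 ∎

      v*y : v * y ≈ k′ *ₗ v
      v*y = begin
        v * y                                        ≈⟨ *-combine v k′ l′ v′ ⟩
        k′ *ₗ (v * e) + (l′ *ₗ (v * f) + v * v′)
          ≈⟨ +-cong (*ₗ-congˡ (ve≈v v∈V))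
               (+-cong (*ₗ-congˡ (vf≈0 v∈V)) (zero-product⁻ VV≐0 v∈V v′∈V)) ⟩
        k′ *ₗ v + (l′ *ₗ 0# + 0#)                    ≈⟨ +-congˡ (+-identityʳ _) ⟩
        k′ *ₗ v + l′ *ₗ 0#                           ≈⟨ +-congˡ (*ₗ-zeroʳ l′) ⟩
        k′ *ₗ v + 0#                                 ≈⟨ +-identityʳ _ ⟩
        k′ *ₗ v                                      ∎

    combine-1 : combine K.1# K.1# 0# ≈ 1#
    combine-1 = begin
      K.1# *ₗ e + (K.1# *ₗ f + 0#)    ≈⟨ +-cong (*ₗ-identityˡ e) (+-identityʳ _) ⟩
      e + K.1# *ₗ f                   ≈⟨ +-congˡ (*ₗ-identityˡ f) ⟩
      e + f                           ≈⟨ e+f≈1 ⟩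
      1#                              ∎

    combine-0 : combine K.0# K.0# 0# ≈ 0#
    combine-0 = begin
      K.0# *ₗ e + (K.0# *ₗ f + 0#)    ≈⟨ +-cong (*ₗ-zeroˡ e) (+-identityʳ _) ⟩
      0# + K.0# *ₗ f                  ≈⟨ +-identityˡ _ ⟩
      K.0# *ₗ f                       ≈⟨ *ₗ-zeroˡ f ⟩
      0#                              ∎

    combine-neg : ∀ k l v → combine (K.- k) (K.- l) (- v) ≈ - combine k l v
    combine-neg k l v = AbelianGroupProps.inverseˡ-unique +-abelianGroup _ _ (begin
      combine (K.- k) (K.- l) (- v) + combine k l v
        ≈⟨ combine-+ (K.- k) k (K.- l) l (- v) v ⟨
      combine (K.- k K.+ k) (K.- l K.+ l) (- v + v)
        ≈⟨ combine-cong (K.-‿inverseˡ k) (K.-‿inverseˡ l) (-‿inverseˡ v) ⟩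
      combine K.0# K.0# 0#                             ≈⟨ combine-0 ⟩
      0#                                               ∎)

    -- The direct sum only makes the summand ke vanish, and reading off `k` = 0 takes `e` ≠ 0. If
    -- `e` were 0, then v = ve would vanish on all of `V`, against dimension at least 4.
    e∉0 : e ∉ˢ 0ˢ
    e∉0 ⟨ lift e≈0 ⟩ = V≉0 dim≥4 λ {v} v∈V →
      trans (sym (ve≈v v∈V)) (trans (*-congˡ e≈0) (zeroʳ v))

    f∉0 : f ∉ˢ 0ˢ
    f∉0 ⟨ lift f≈0 ⟩ = V≉0 dim≥4 λ {v} v∈V →
      trans (sym (fv≈v v∈V)) (trans (*-congʳ f≈0) (zeroˡ v))

    combine≈0 : ∀ {k l v} → v ∈ members V → combine k l v ≈ 0# →
                k K.≈ K.0# × l K.≈ K.0# × v ≈ 0#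
    combine≈0 {k} {l} {v} v∈V sum≈0 =
      coefficient-zero e∉0 ⟨ lift (summand≈0 0F) ⟩ ,
      coefficient-zero f∉0 ⟨ lift (summand≈0 1F) ⟩ ,
      summand≈0 2F
      where
      summand≈0 = proj₂ directSum (k *ₗ e ∷ l *ₗ f ∷ v ∷ [])
        (λ { 0F → k , lift refl ; 1F → l , lift refl ; 2F → v∈V })
        (trans (+-congˡ (+-congˡ (+-identityʳ v))) sum≈0)

    combine-injective : ∀ {k k′ l l′ v v′} → v ∈ members V → v′ ∈ members V →
      combine k l v ≈ combine k′ l′ v′ → k K.≈ k′ × l K.≈ l′ × v ≈ v′
    combine-injective {k} {k′} {l} {l′} {v} {v′} v∈V v′∈V eq
      with combine≈0 {k K.+ K.- k′} {l K.+ K.- l′} {v + - v′}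
             (+-closed V v∈V (-ᴹ-closed V v′∈V)) (begin
        combine (k K.+ K.- k′) (l K.+ K.- l′) (v + - v′)
          ≈⟨ combine-+ k (K.- k′) l (K.- l′) v (- v′) ⟩
        combine k l v + combine (K.- k′) (K.- l′) (- v′)  ≈⟨ +-cong eq (combine-neg k′ l′ v′) ⟩
        combine k′ l′ v′ + - combine k′ l′ v′             ≈⟨ -‿inverseʳ _ ⟩
        0#                                                ∎)
    ... | k-k′≈0 , l-l′≈0 , v-v′≈0 =
      AbelianGroupProps.x∙y⁻¹≈ε⇒x≈y K.+-abelianGroup k k′ k-k′≈0 ,
      AbelianGroupProps.x∙y⁻¹≈ε⇒x≈y K.+-abelianGroup l l′ l-l′≈0 ,
      AbelianGroupProps.x∙y⁻¹≈ε⇒x≈y +-abelianGroup v v′ v-v′≈0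

    -- The (1,1) entry is the coefficient of `f` and the (2,2) entry that of `e`, because it is `f`
    -- that acts as the identity on the left of `V`.
    assemble : B.Carrier → Carrier
    assemble (l , (v , _) , k) = combine k l v

    assemble-isRingMonomorphism : IsRingMonomorphism assemble
    assemble-isRingMonomorphism = record
      { isRingHomomorphism = record
        { isSemiringHomomorphism = record
          { isNearSemiringHomomorphism = record
            { +-isMonoidHomomorphism = record
              { isMagmaHomomorphism = record
                { isRelHomomorphism = record
                  { cong = λ (l≈ , v≈ , k≈) → combine-cong k≈ l≈ v≈ }
                ; homo = λ (l , (v , _) , k) (l′ , (v′ , _) , k′) →
                    combine-+ k k′ l l′ v v′
                }
              ; ε-homo = combine-0
              }
            ; *-homo = λ (l , (_ , v∈V) , k) (l′ , (_ , v′∈V) , k′) →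
                combine-* k k′ l l′ v∈V v′∈V
            }
          ; 1#-homo = combine-1
          }
        ; -‿homo = λ (l , (v , _) , k) → combine-neg k l v
        }
      ; injective = λ {(l , (_ , v∈V) , k)} {(l′ , (_ , v′∈V) , k′)} eq →
          let k≈ , l≈ , v≈ = combine-injective v∈V v′∈V eq in l≈ , v≈ , k≈
      }

    disassemble : ∀ x → ∃[ t ] assemble t ≈ x
    disassemble x with decomposeIII x
    ... | k , l , v , v∈V , x≈ = (l , (v , v∈V) , k) , sym x≈

    peirce⇒triangular : A ≅ Triangular K (asModule V)
    peirce⇒triangular = splitMonomorphism⇒≅ A B assemble-isRingMonomorphism
      (λ m (l , (v , _) , k) → combine-*ₗ m k l v)
      (proj₁ ∘ disassemble) (proj₂ ∘ disassemble)

  -- Case (iii) from an isomorphism with a triangular algebra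

  module _ (W : LeftModule K.ring (c ⊔ ℓ ⊔ a ⊔ ℓa) ℓa) (A≅B : A ≅ Triangular K W) where
    private
      module W = LeftModule W
      module B = Algebra (Triangular K W)
      open _≅_ A≅B renaming (*ₗ-homo to φ-*ₗ-homo)
      module φ = RingMorphisms.IsRingIsomorphism isRingIsomorphism

    -- The diagonal entries serve as the forms `L` and `R`: a matrix with (1,1) entry 0 times one
    -- with (2,2) entry 0 is 0. A preimage of `E₂₂` is then the required `e`.
    triangular⇒caseIII : CaseIII
    triangular⇒caseIII = PeirceDecomposition.caseIII left right MN≈0′
      {e = proj₁ (φ.surjective E₂₂)} (proj₁ φe≈E₂₂) (proj₂ (proj₂ φe≈E₂₂))
      where
      left right : UnitalForm 1#
      left = record
        { ⟦_⟧     = λ x → proj₁ ⟦ x ⟧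
        ; ⟦⟧-cong = λ x≈y → proj₁ (φ.⟦⟧-cong x≈y)
        ; +-homo  = λ x y → proj₁ (φ.+-homo x y)
        ; *ₗ-homo = λ k x → proj₁ (φ-*ₗ-homo k x)
        ; 1-homo  = proj₁ φ.1#-homo
        }
      right = record
        { ⟦_⟧     = λ x → proj₂ (proj₂ ⟦ x ⟧)
        ; ⟦⟧-cong = λ x≈y → proj₂ (proj₂ (φ.⟦⟧-cong x≈y))
        ; +-homo  = λ x y → proj₂ (proj₂ (φ.+-homo x y))
        ; *ₗ-homo = λ k x → proj₂ (proj₂ (φ-*ₗ-homo k x))
        ; 1-homo  = proj₂ (proj₂ φ.1#-homo)
        }

      MN≈0′ : ∀ {x y} → proj₁ ⟦ x ⟧ K.≈ K.0# → proj₂ (proj₂ ⟦ y ⟧) K.≈ K.0# → x * y ≈ 0#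
      MN≈0′ {x} {y} Lx≈0 Ry≈0 = φ.injective (B.trans (φ.*-homo x y)
        (B.trans
          ( K.trans (K.*-congʳ Lx≈0) (K.zeroˡ _)
          , W.≈ᴹ-trans (W.+ᴹ-cong (W.≈ᴹ-trans (W.*ₗ-congʳ Lx≈0) (W.*ₗ-zeroˡ _))
                                  (W.≈ᴹ-trans (W.*ₗ-congʳ Ry≈0) (W.*ₗ-zeroˡ _)))
              (W.+ᴹ-identityˡ W.0ᴹ)
          , K.trans (K.*-congˡ Ry≈0) (K.zeroʳ _)
          )
          (B.sym φ.0#-homo)))

      E₂₂ : B.Carrier
      E₂₂ = K.0# , W.0ᴹ , K.1#

      φe≈E₂₂ : ⟦ proj₁ (φ.surjective E₂₂) ⟧ B.≈ E₂₂
      φe≈E₂₂ = proj₂ (φ.surjective E₂₂) refl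

  caseIII⇔triangular : CaseIII⇔Triangular
  caseIII⇔triangular = (λ V e f P → peirce⇒triangular P) , triangular⇒caseIII

theorem5p7 : ∀ {c ℓ a ℓa : Level} →
    ExcludedMiddle (c ⊔ ℓ ⊔ a ⊔ ℓa) →
    (K : Field c ℓ) (A : Algebra K a ℓa) →
    Dim≥ (Algebra.leftModule A) 4 →
    ExactlyOneOf₃ (Cases.CaseI A) (Cases.CaseII A) (Cases.CaseIII A)
    × Cases.CaseIII⇔Triangular A
theorem5p7 em K A dim≥4 =
  Trichotomy.exactlyOne em K A dim≥4 , TriangularForm.caseIII⇔triangular em K A dim≥4
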